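{- Let $\omega\ge 1$ be an integer. The supremum, over all unit interval graphs $G$ of maximum clique size $\omega$, of the expected number of colors used by FirstFit on $G$ in the random order model equals $2\omega-1$.
   Context: A unit interval graph is a finite simple graph that is the intersection graph of a finite family of unit-length intervals on the real line. FirstFit: given a finite simple graph and an ordering of its vertices, the vertices are processed in that order, and each vertex irrevocably receives the smallest positive integer (color) that is not the color of any of its neighbors processed earlier. The number of colors used is the number of distinct colors assigned. Random order model: the graph is fixed and the ordering of its vertices is chosen uniformly at random among all orderings; the expectation is over this choice. -}

module Defs where

open import Data.Empty using (⊥-elim)
open import Data.Fin using (Fin; toℕ)
import Data.Fin.Properties as Fin
open import Data.Fin.Subset using (Subset; _∈_; ∣_∣)
open import Data.Integer using (+_)
open import Data.List using (List; []; _∷_; _++_; length; map; concatMap; filter; foldl; deduplicate; allFin)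
import Data.List.Membership.Propositional as List
open import Data.List.Membership.Propositional using (lose; find)
open import Data.List.Membership.Propositional.Properties using (∈-map⁺; ∈-map⁻; ∈-concatMap⁺; ∈-concatMap⁻; ∈-∃++)
import Data.List.Properties as List
open import Data.List.Relation.Unary.All using (All; []; _∷_)
import Data.List.Relation.Unary.All as All
import Data.List.Relation.Unary.All.Properties as All
open import Data.List.Relation.Unary.AllPairs using ([]; _∷_)
import Data.List.Relation.Unary.AllPairs as AllPairs
import Data.List.Relation.Unary.AllPairs.Properties as AllPairs
open import Data.List.Relation.Unary.Any using (here; there; index)
open import Data.List.Relation.Unary.Any.Properties using (lookup-index)
open import Data.List.Relation.Unary.Unique.Propositional using (Unique)
import Data.List.Relation.Unary.Unique.Propositional.Properties as Unique
open import Data.List.Relation.Binary.Permutation.Propositional using (_↭_; ↭-refl; ↭-sym; ↭-trans; prep; swap)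
open import Data.List.Relation.Binary.Permutation.Propositional.Properties using (↭-length; ∈-resp-↭; ↭-empty-inv; drop-mid)
open import Data.List.Membership.DecPropositional using () renaming (_∈?_ to member?)
open import Data.Nat using (ℕ; zero; suc; _+_; _*_; _≤_; _<_; _!; z≤n; s≤s)
open import Data.Nat.ListAction using (sum)
import Data.Nat.Properties as ℕ
open import Data.Product using (Σ; ∃; _×_; _,_; proj₁; proj₂)
open import Data.Rational using (ℚ; _/_; 1ℚ) renaming (_+_ to _+ℚ_; _-_ to _-ℚ_; _≤_ to _≤ℚ_; _<_ to _<ℚ_)
import Data.Rational.Properties as ℚ
open import Data.Sum using (_⊎_; inj₁; inj₂)
open import Function.Bundles using (_⇔_; mk⇔; Equivalence)
open import Relation.Binary.PropositionalEquality using (_≡_; _≢_; refl; sym; trans; cong; cong₂; subst; module ≡-Reasoning)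
open import Relation.Nullary using (¬_; yes; no)
open import Relation.Binary using (Decidable; Symmetric)
open import Relation.Unary using (Pred)

-- Real numbers as two-sided Dedekind cuts of ℚ.
record ℝ : Set₁ where
  field
    L U         : ℚ → Set
    L-inhabited : ∃ L
    U-inhabited : ∃ U
    L-rounded   : ∀ q → L q ⇔ (∃ λ r → q <ℚ r × L r)
    U-rounded   : ∀ q → U q ⇔ (∃ λ r → r <ℚ q × U r)
    disjoint    : ∀ q → ¬ (L q × U q)
    located     : ∀ q r → q <ℚ r → L q ⊎ U r

open ℝ

infix 4 _≤ℝ_

_≤ℝ_ : ℝ → ℝ → Set
x ≤ℝ y = ∀ q → L x q → L y q

private
  -+-cancel : ∀ q → (q +ℚ 1ℚ) -ℚ 1ℚ ≡ q
  -+-cancel q = trans (ℚ.+-assoc q 1ℚ _) (ℚ.+-identityʳ q)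

  +--cancel : ∀ q → (q -ℚ 1ℚ) +ℚ 1ℚ ≡ q
  +--cancel q = trans (ℚ.+-assoc q _ 1ℚ) (ℚ.+-identityʳ q)

  <-shift : ∀ q {r} → q -ℚ 1ℚ <ℚ r → q <ℚ r +ℚ 1ℚ
  <-shift q p = subst (_<ℚ _) (+--cancel q) (ℚ.+-monoˡ-< 1ℚ p)

  >-shift : ∀ q {r} → r <ℚ q -ℚ 1ℚ → r +ℚ 1ℚ <ℚ q
  >-shift q p = subst (_ <ℚ_) (+--cancel q) (ℚ.+-monoˡ-< 1ℚ p)

_+1 : ℝ → ℝ
x +1 = record
  { L           = λ q → L x (q -ℚ 1ℚ)
  ; U           = λ q → U x (q -ℚ 1ℚ)
  ; L-inhabited = let q , l = L-inhabited x in q +ℚ 1ℚ , subst (L x) (sym (-+-cancel q)) l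
  ; U-inhabited = let q , u = U-inhabited x in q +ℚ 1ℚ , subst (U x) (sym (-+-cancel q)) u
  ; L-rounded   = λ q → mk⇔
      (λ l → let r , q<r , lr = Equivalence.to (L-rounded x _) l in
             r +ℚ 1ℚ , <-shift q q<r , subst (L x) (sym (-+-cancel r)) lr)
      (λ (r , q<r , lr) → Equivalence.from (L-rounded x _) (r -ℚ 1ℚ , ℚ.+-monoˡ-< _ q<r , lr))
  ; U-rounded   = λ q → mk⇔
      (λ u → let r , r<q , ur = Equivalence.to (U-rounded x _) u in
             r +ℚ 1ℚ , >-shift q r<q , subst (U x) (sym (-+-cancel r)) ur)
      (λ (r , r<q , ur) → Equivalence.from (U-rounded x _) (r -ℚ 1ℚ , ℚ.+-monoˡ-< _ r<q , ur))
  ; disjoint    = λ q → disjoint x (q -ℚ 1ℚ)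
  ; located     = λ q r q<r → located x _ _ (ℚ.+-monoˡ-< _ q<r)
  }

infix 4 _∈[_,_+1]

_∈[_,_+1] : ℝ → ℝ → ℝ → Set
x ∈[ a , b +1] = a ≤ℝ x × x ≤ℝ b +1

record Graph (n : ℕ) : Set₁ where
  field
    Adj    : Fin n → Fin n → Set
    adj?   : Decidable Adj
    irrefl : ∀ v → ¬ Adj v v
    symm   : Symmetric Adj

module _ {n : ℕ} (G : Graph n) where
  open Graph G

  -- The interval assigned to v is the closed interval [ left v , left v + 1 ].
  UnitInterval : Set₁
  UnitInterval = Σ (Fin n → ℝ) λ left → ∀ u v →
    Adj u v ⇔ (u ≢ v × ∃ λ x → x ∈[ left u , left u +1] × x ∈[ left v , left v +1])

  Clique : Subset n → Set
  Clique S = ∀ u v → u ∈ S → v ∈ S → u ≢ v → Adj u v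

  MaxCliqueSize : ℕ → Set
  MaxCliqueSize ω = (∃ λ S → Clique S × ∣ S ∣ ≡ ω) × (∀ S → Clique S → ∣ S ∣ ≤ ω)

-- Upward search from k for a number not in cs; fuel is an upper bound on the
-- number of steps.
searchFree : (fuel k : ℕ) → List ℕ → ℕ
searchFree zero       k cs = k
searchFree (suc fuel) k cs with member? ℕ._≟_ k cs
... | yes _ = searchFree fuel (suc k) cs
... | no  _ = k

leastFree : List ℕ → ℕ
leastFree cs = searchFree (length cs) 1 cs

module _ {n : ℕ} (G : Graph n) where
  open Graph G

  -- The list contains the processed vertices with their colours, latest first.
  colourNext : List (Fin n × ℕ) → Fin n → List (Fin n × ℕ)
  colourNext done v = (v , leastFree (map proj₂ (filter (λ uc → adj? v (proj₁ uc)) done))) ∷ done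

  firstFit : List (Fin n) → List (Fin n × ℕ)
  firstFit = foldl colourNext []

  coloursUsed : List (Fin n) → ℕ
  coloursUsed σ = length (deduplicate ℕ._≟_ (map proj₂ (firstFit σ)))

insertions : ∀ {a} {A : Set a} → A → List A → List (List A)
insertions x []       = (x ∷ []) ∷ []
insertions x (y ∷ ys) = (x ∷ y ∷ ys) ∷ map (y ∷_) (insertions x ys)

permutations : ∀ {a} {A : Set a} → List A → List (List A)
permutations []       = [] ∷ []
permutations (x ∷ xs) = concatMap (insertions x) (permutations xs)

orderings : ∀ n → List (List (Fin n))
orderings n = permutations (allFin n)

-- The mean over all n! orderings; see length-orderings, ∈-orderings and
-- orderings-unique below.
expectedColours : ∀ {n} → Graph n → ℚ
expectedColours {n} G = (+ sum (map (coloursUsed G) (orderings n))) / (n !)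
  where instance _ = n ℕ.!≢0

-- ℚ is dense in ℝ, so letting r range over ℚ only still makes s the
-- least upper bound among all reals.
IsSupremum : ∀ {ℓ} → Pred ℚ ℓ → ℚ → Set ℓ
IsSupremum S s = (∀ q → S q → q ≤ℚ s) × (∀ r → r <ℚ s → ∃ λ q → S q × r <ℚ q)

IsSupremum⇒least : ∀ {ℓ} {S : Pred ℚ ℓ} {s} → IsSupremum S s →
                   ∀ b → (∀ q → S q → q ≤ℚ b) → s ≤ℚ b
IsSupremum⇒least (_ , approx) b ub = ℚ.≮⇒≥ λ b<s →
  let q , q∈S , b<q = approx b b<s in ℚ.<-irrefl refl (ℚ.<-≤-trans b<q (ub q q∈S))

private
  searchFree-spec : ∀ fuel k cs → length cs < fuel + k → 1 ≤ k →
                    (∀ d → 1 ≤ d → d < k → d List.∈ cs) →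
                    let c = searchFree fuel k cs in
                    1 ≤ c × ¬ (c List.∈ cs) × (∀ d → 1 ≤ d → d < c → d List.∈ cs)
  searchFree-spec zero k cs len 1≤k below = 1≤k , notIn , below
    where
    notIn : ¬ (k List.∈ cs)
    notIn k∈cs =
      let i , j , i<j , eq = Fin.pigeonhole len at
      in ℕ.<⇒≢ i<j (ℕ.suc-injective
           (trans (lookup-index (∈i i)) (trans (cong (Data.List.lookup cs) eq) (sym (lookup-index (∈i j))))))
      where
      upTo : ∀ d → 1 ≤ d → d ≤ k → d List.∈ cs
      upTo d 1≤d d≤k with ℕ.m≤n⇒m<n∨m≡n d≤k
      ... | inj₁ d<k  = below d 1≤d d<k
      ... | inj₂ refl = k∈cs
      ∈i : (i : Fin k) → suc (toℕ i) List.∈ cs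
      ∈i i = upTo _ (s≤s z≤n) (Fin.toℕ<n i)
      at : Fin k → Fin (length cs)
      at i = index (∈i i)
  searchFree-spec (suc fuel) k cs len 1≤k below with member? ℕ._≟_ k cs
  ... | no  k∉cs = 1≤k , k∉cs , below
  ... | yes k∈cs = searchFree-spec fuel (suc k) cs
                     (subst (length cs <_) (sym (ℕ.+-suc fuel k)) len) (s≤s z≤n) below′
    where
    below′ : ∀ d → 1 ≤ d → d < suc k → d List.∈ cs
    below′ d 1≤d (s≤s d≤k) with ℕ.m≤n⇒m<n∨m≡n d≤k
    ... | inj₁ d<k  = below d 1≤d d<k
    ... | inj₂ refl = k∈cs

leastFree-spec : ∀ cs → let c = leastFree cs in
                 1 ≤ c × ¬ (c List.∈ cs) × (∀ d → 1 ≤ d → d < c → d List.∈ cs)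
leastFree-spec cs = searchFree-spec (length cs) 1 cs
  (subst (length cs <_) (ℕ.+-comm 1 (length cs)) ℕ.≤-refl) ℕ.≤-refl
  λ { (suc d) _ (s≤s ()) }

module _ {a} {A : Set a} where

  private
    insertions-sound : ∀ (x : A) ys {zs} → zs List.∈ insertions x ys → zs ↭ x ∷ ys
    insertions-sound x []       (here refl) = ↭-refl
    insertions-sound x (y ∷ ys) (here refl) = ↭-refl
    insertions-sound x (y ∷ ys) (there p) with ∈-map⁻ (y ∷_) p
    ... | ws , q , refl = ↭-trans (prep y (insertions-sound x ys q)) (swap y x ↭-refl)

    insertions-complete : ∀ (x : A) ys zs → (ys ++ x ∷ zs) List.∈ insertions x (ys ++ zs)
    insertions-complete x []       []       = here refl
    insertions-complete x []       (z ∷ zs) = here refl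
    insertions-complete x (y ∷ ys) zs       = there (∈-map⁺ (y ∷_) (insertions-complete x ys zs))

    length-insertions : ∀ (x : A) ys → length (insertions x ys) ≡ suc (length ys)
    length-insertions x []       = refl
    length-insertions x (y ∷ ys) =
      cong suc (trans (List.length-map (y ∷_) (insertions x ys)) (length-insertions x ys))

    insertions-injective : ∀ {x : A} as bs {zs} → ¬ (x List.∈ as) → ¬ (x List.∈ bs) →
                           zs List.∈ insertions x as → zs List.∈ insertions x bs → as ≡ bs
    insertions-injective []       []       _  _  _ _ = refl
    insertions-injective []       (b ∷ bs) _  nb (here refl) (here ())
    insertions-injective []       (b ∷ bs) _  nb (here refl) (there q) with ∈-map⁻ (b ∷_) q
    ... | _ , _ , refl = ⊥-elim (nb (here refl))
    insertions-injective (a ∷ as) []       na _  (here refl) (here ())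
    insertions-injective (a ∷ as) []       na _  (there p)   (here refl) with ∈-map⁻ (a ∷_) p
    ... | _ , _ , refl = ⊥-elim (na (here refl))
    insertions-injective (a ∷ as) (b ∷ bs) na nb (here refl) (here refl) = refl
    insertions-injective (a ∷ as) (b ∷ bs) na nb (here refl) (there q) with ∈-map⁻ (b ∷_) q
    ... | _ , _ , refl = ⊥-elim (nb (here refl))
    insertions-injective (a ∷ as) (b ∷ bs) na nb (there p) (here refl) with ∈-map⁻ (a ∷_) p
    ... | _ , _ , refl = ⊥-elim (na (here refl))
    insertions-injective (a ∷ as) (b ∷ bs) na nb (there p) (there q)
      with ∈-map⁻ (a ∷_) p | ∈-map⁻ (b ∷_) q
    ... | _ , p′ , refl | _ , q′ , refl =
      cong (a ∷_) (insertions-injective as bs (λ i → na (there i)) (λ i → nb (there i)) p′ q′)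

    insertions-unique : ∀ {x : A} ys → ¬ (x List.∈ ys) → Unique (insertions x ys)
    insertions-unique     []       _  = [] ∷ []
    insertions-unique {x} (y ∷ ys) x∉ =
      All.map⁺ (All.tabulate λ _ eq → x∉ (here (List.∷-injectiveˡ eq))) ∷
      Unique.map⁺ List.∷-injectiveʳ (insertions-unique ys (λ i → x∉ (there i)))

    permutations-sound : ∀ (xs : List A) {ys} → ys List.∈ permutations xs → ys ↭ xs
    permutations-sound []       (here refl) = ↭-refl
    permutations-sound (x ∷ xs) p with find (∈-concatMap⁻ (insertions x) p)
    ... | zs , q , r = ↭-trans (insertions-sound x zs r) (prep x (permutations-sound xs q))

    permutations-complete : ∀ (xs : List A) {ys} → ys ↭ xs → ys List.∈ permutations xs
    permutations-complete []       p with refl ← ↭-empty-inv p = here refl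
    permutations-complete (x ∷ xs) p with ∈-∃++ (∈-resp-↭ (↭-sym p) (here refl))
    ... | as , bs , refl = ∈-concatMap⁺ (insertions x)
      (lose (permutations-complete xs (drop-mid as [] p)) (insertions-complete x as bs))

    length-concatMap : ∀ (x : A) k (yss : List (List A)) → All (λ ys → length ys ≡ k) yss →
                       length (concatMap (insertions x) yss) ≡ length yss * suc k
    length-concatMap x k []         []         = refl
    length-concatMap x k (ys ∷ yss) (eq ∷ eqs) =
      trans (List.length-++ (insertions x ys))
        (cong₂ _+_ (trans (length-insertions x ys) (cong suc eq)) (length-concatMap x k yss eqs))

  ∈-permutations : ∀ (xs ys : List A) → ys List.∈ permutations xs ⇔ (ys ↭ xs)
  ∈-permutations xs ys = mk⇔ (permutations-sound xs) (permutations-complete xs)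

  length-permutations : ∀ (xs : List A) → length (permutations xs) ≡ length xs !
  length-permutations []       = refl
  length-permutations (x ∷ xs) = begin
    length (concatMap (insertions x) (permutations xs))
      ≡⟨ length-concatMap x (length xs) (permutations xs)
           (All.tabulate λ p → ↭-length (permutations-sound xs p)) ⟩
    length (permutations xs) * suc (length xs)
      ≡⟨ cong (_* suc (length xs)) (length-permutations xs) ⟩
    length xs ! * suc (length xs)
      ≡⟨ ℕ.*-comm (length xs !) _ ⟩
    suc (length xs) * length xs ! ∎
    where open ≡-Reasoning

  permutations-unique : ∀ {xs : List A} → Unique xs → Unique (permutations xs)
  permutations-unique {[]}     []         = [] ∷ []
  permutations-unique {x ∷ xs} (x∉ ∷ uxs) =
    Unique.concat⁺
      (All.map⁺ (All.tabulate λ {ys} p → insertions-unique ys (fresh p)))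
      (AllPairs.map⁺ (pairs (All.tabulate fresh) (permutations-unique uxs)))
    where
    fresh : ∀ {ys} → ys List.∈ permutations xs → ¬ (x List.∈ ys)
    fresh p x∈ys = All.lookup x∉ (∈-resp-↭ (permutations-sound xs p) x∈ys) refl

    pairs : ∀ {yss} → All (λ ys → ¬ (x List.∈ ys)) yss → Unique yss →
            AllPairs.AllPairs (λ as bs → ∀ {zs} →
              ¬ (zs List.∈ insertions x as × zs List.∈ insertions x bs)) yss
    pairs []       []       = []
    pairs (f ∷ fs) (u ∷ us) =
      All.zipWith (λ (g , as≢bs) {_} (p , q) → as≢bs (insertions-injective _ _ f g p q)) (fs , u) ∷
      pairs fs us

∈-orderings : ∀ n (σ : List (Fin n)) → σ List.∈ orderings n ⇔ (σ ↭ allFin n)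
∈-orderings n = ∈-permutations (allFin n)

orderings-unique : ∀ n → Unique (orderings n)
orderings-unique n = permutations-unique (Unique.allFin⁺ n)

length-orderings : ∀ n → length (orderings n) ≡ n !
length-orderings n = trans (length-permutations (allFin n)) (cong _! (List.length-tabulate {n = n} (λ i → i)))

-- Upper bound: the neighbours of a vertex v of a unit interval graph split into
-- those starting to the left of v and the others, and each part forms a clique
-- together with v. So v has at most 2ω - 2 neighbours and FirstFit never needs a
-- colour above 2ω - 1.
--
-- Lower bound: some unit interval graph has an ordering on which FirstFit uses
-- 2ω - 1 colours. In the disjoint union of many copies of this graph, a random
-- ordering induces this bad ordering on at least one of the copies with
-- probability close to 1.
module Submission where

open import Data.Bool using (true; false)
open import Data.Empty using (⊥-elim)
import Data.Fin as Fin
open import Data.Fin using (Fin; zero; suc; splitAt; join; _↑ˡ_; _↑ʳ_; toℕ)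
import Data.Fin.Properties as Fin
open import Data.Fin.Properties using (suc-injective)
open import Data.Fin.Subset using (Subset; _∈_; ∣_∣; inside; ⊥)
import Data.Fin.Subset.Properties as Subset
import Data.Integer as ℤ
open import Data.Integer using (+_; +≤+; -[1+_]; +<+; -<+)
import Data.Integer.Properties as ℤ
open import Data.List using (List; []; _∷_; _++_; length; map; lookup; allFin; filter; deduplicate; upTo; foldl; mapMaybe; concatMap; tabulate; cartesianProductWith)
import Data.List.Membership.Propositional as List
open import Data.List.Membership.Propositional using (lose)
open import Data.List.Membership.Propositional.Properties using (∈-map⁺; ∈-map⁻; ∈-∃++; ∈-++⁺ˡ; ∈-++⁺ʳ; ∈-++⁻; ∈-deduplicate⁺; ∈-deduplicate⁻; ∈-upTo⁺; ∈-lookup; ∈-filter⁺; ∈-filter⁻; ∈-concatMap⁺; ∈-allFin; ∈-cartesianProductWith⁺; ∈-cartesianProductWith⁻)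
import Data.List.Properties as List
open import Data.List.Relation.Binary.Permutation.Propositional using (_↭_; ↭-sym; ↭-trans; ↭-reflexive; ↭⇒↭ₛ)
open import Data.List.Relation.Binary.Permutation.Propositional.Properties using (mapMaybe-↭; ↭-length; ∈-resp-↭)
import Data.List.Relation.Binary.Permutation.Setoid.Properties as Perm
import Data.List.Relation.Unary.All as All
open import Data.List.Relation.Unary.All using (All; []; _∷_)
import Data.List.Relation.Unary.All.Properties as All
import Data.List.Relation.Unary.AllPairs as AllPairs
open import Data.List.Relation.Unary.AllPairs using (AllPairs; []; _∷_)
import Data.List.Relation.Unary.AllPairs.Properties as AllPairs
open import Data.List.Relation.Unary.Any using (here; there; index)
open import Data.List.Relation.Unary.Any.Properties using (lookup-index)
import Data.List.Relation.Unary.Sorted.TotalOrder.Properties as Sorted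
import Data.List.Relation.Unary.Unique.DecPropositional.Properties as DecUnique
open import Data.List.Relation.Unary.Unique.Propositional using (Unique)
import Data.List.Relation.Unary.Unique.Propositional.Properties as Unique
import Data.List.Sort as Sort
import Data.Maybe as Maybe
open import Data.Maybe using (Maybe; just; nothing)
open import Data.Nat using (ℕ; _+_; _*_; _∸_; _≤_; _<_; s≤s; z≤n; zero; suc; NonZero; _!; _%_; >-nonZero) renaming (_/_ to _div_)
open import Data.Nat.DivMod using (m≡m%n+[m/n]*n; m%n<n; [m+kn]%n≡m%n; m*n%n≡0; m%n%n≡m%n; m<n*o⇒m/o<n)
open import Data.Nat.ListAction using (sum)
import Data.Nat.Properties as ℕ
open import Data.Nat.Tactic.RingSolver using (solve-∀)
open import Data.Product using (∃; _×_; _,_; proj₁; proj₂; Σ)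
open import Data.Rational using (ℚ; _/_; 0ℚ; 1ℚ; toℚᵘ; mkℚ; ↥_; ↧_; ↧ₙ_) renaming (_+_ to _+ℚ_; _-_ to _-ℚ_; _≤_ to _≤ℚ_; _<_ to _<ℚ_; -_ to -ℚ_)
import Data.Rational.Properties as ℚ
open import Data.Rational.Unnormalised using (mkℚᵘ; _≃_; 1ℚᵘ; *≡*) renaming (*≤* to *≤*ᵘ; _+_ to _+ᵘ_; *<* to *<*ᵘ)
import Data.Rational.Unnormalised.Properties as ℚᵘ
open import Data.Sum using (_⊎_; inj₁; inj₂; isInj₁; isInj₂; [_,_]′)
open import Data.Unit using (⊤; tt)
open import Data.Vec using (_∷_; []; _[_]≔_; here; there)
open import Defs
open import Effect.Monad using (RawMonad)
open import Function using (_∘_)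
open import Function.Bundles using (_⇔_; mk⇔; Equivalence)
open import Relation.Binary using (tri<; tri≈; tri>; DecTotalOrder)
import Relation.Binary.Construct.On as On
open import Relation.Binary.PropositionalEquality
open import Relation.Nullary using (¬_; yes; no; ¬?; Dec)
open import Relation.Nullary.Decidable using (_×-dec_; decidable-stable; ¬¬-excluded-middle)
open import Relation.Nullary.Negation using (¬¬-Monad)
open import Relation.Unary using (Decidable)

-- The orderings that a random ordering of a disjoint union induces on the parts are independent.
-- This is obtained by counting: every ordering of the union is a shuffle of an ordering of each
-- part, and the inequalities keep the factorials multiplied out, so that no probabilities occur.
-- The failure probability decays geometrically in the number of copies, but the weaker bound f / (f
-- + N) also tends to 0 and avoids powers. The order of Dedekind cuts is not decidable. The upper
-- bound compares only finitely many left ends and concludes with an inequality of natural numbers,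
-- so excluded middle may be used under a double negation. In the lower bound, left ends are natural
-- numbers over a common denominator. The clique number of the constructed graphs is not read off
-- from the geometry: a list of ω pairwise adjacent vertices bounds it from below and a proper
-- colouring with ω colours from above. Both certificates carry over to disjoint unions.

-- Counting with duplicate-free lists and finite subsets

unique-⊆⇒length-≤ : ∀ {a} {A : Set a} {xs ys : List A} → Unique xs →
                    (∀ {x} → x List.∈ xs → x List.∈ ys) → length xs ≤ length ys
unique-⊆⇒length-≤ {xs = []} [] sub = z≤n
unique-⊆⇒length-≤ {xs = x ∷ xs} (x∉ ∷ u) sub with ∈-∃++ (sub (here refl))
... | as , bs , refl = begin
  suc (length xs)         ≤⟨ s≤s (unique-⊆⇒length-≤ u sub′) ⟩
  suc (length (as ++ bs)) ≡⟨ cong suc (List.length-++ as) ⟩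
  suc (length as + length bs) ≡⟨ ℕ.+-suc (length as) (length bs) ⟨
  length as + suc (length bs) ≡⟨ List.length-++ as ⟨
  length (as ++ x ∷ bs)   ∎
  where
  open ℕ.≤-Reasoning
  sub′ : ∀ {y} → y List.∈ xs → y List.∈ as ++ bs
  sub′ y∈ with ∈-++⁻ as (sub (there y∈))
  ... | inj₁ p         = ∈-++⁺ˡ p
  ... | inj₂ (here eq) = ⊥-elim (All.lookup x∉ y∈ (sym eq))
  ... | inj₂ (there p) = ∈-++⁺ʳ as p

unique-<⇒length-≤ : ∀ {xs m} → Unique xs → All (_< m) xs → length xs ≤ m
unique-<⇒length-≤ {xs} {m} u b = subst (length xs ≤_) (List.length-upTo m)
  (unique-⊆⇒length-≤ u λ x∈ → ∈-upTo⁺ (All.lookup b x∈))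

unique-lookup-injective : ∀ {a} {A : Set a} {xs : List A} → Unique xs →
                          ∀ i j → lookup xs i ≡ lookup xs j → i ≡ j
unique-lookup-injective (x∉ ∷ u) zero    zero    eq = refl
unique-lookup-injective (x∉ ∷ u) zero    (suc j) eq = ⊥-elim (All.lookup x∉ (∈-lookup j) eq)
unique-lookup-injective (x∉ ∷ u) (suc i) zero    eq = ⊥-elim (All.lookup x∉ (∈-lookup i) (sym eq))
unique-lookup-injective (x∉ ∷ u) (suc i) (suc j) eq = cong suc (unique-lookup-injective u i j eq)

distinct : List ℕ → ℕ
distinct cs = length (deduplicate ℕ._≟_ cs)

distinct-mono : ∀ {cs ds} → (∀ {c} → c List.∈ cs → c List.∈ ds) → distinct cs ≤ distinct ds
distinct-mono {cs} {ds} sub = unique-⊆⇒length-≤ (DecUnique.deduplicate-! ℕ._≟_ cs)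
  λ c∈ → ∈-deduplicate⁺ ℕ._≟_ (sub (∈-deduplicate⁻ ℕ._≟_ cs c∈))

distinct-≤ : ∀ {cs m} → All (λ c → 1 ≤ c × c ≤ m) cs → distinct cs ≤ m
distinct-≤ {cs} {m} b = subst (distinct cs ≤_) (trans (List.length-map suc (upTo m)) (List.length-upTo m))
  (unique-⊆⇒length-≤ (DecUnique.deduplicate-! ℕ._≟_ cs) sub)
  where
  sub : ∀ {c} → c List.∈ deduplicate ℕ._≟_ cs → c List.∈ map suc (upTo m)
  sub {c} c∈ with c | All.lookup b (∈-deduplicate⁻ ℕ._≟_ cs c∈)
  ... | suc c | s≤s _ , c<m = ∈-map⁺ suc (∈-upTo⁺ c<m)

≤-distinct : ∀ {cs m} → (∀ c → 1 ≤ c → c ≤ m → c List.∈ cs) → m ≤ distinct cs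
≤-distinct {cs} {m} all = subst (_≤ distinct cs) (trans (List.length-map suc (upTo m)) (List.length-upTo m))
  (unique-⊆⇒length-≤ (Unique.map⁺ ℕ.suc-injective (Unique.upTo⁺ m)) sub)
  where
  open import Data.List.Membership.Propositional.Properties using (∈-upTo⁻)
  sub : ∀ {c} → c List.∈ map suc (upTo m) → c List.∈ deduplicate ℕ._≟_ cs
  sub c∈ with ∈-map⁻ suc c∈
  ... | c′ , p , refl = ∈-deduplicate⁺ ℕ._≟_ (all _ (s≤s z≤n) (∈-upTo⁻ p))

-- `MaxCliqueSize` speaks of `Subset`s, the counting arguments of duplicate-free lists; `fromList`
-- and `toList` carry cliques from one to the other.
fromList : ∀ {n} → List (Fin n) → Subset n
fromList []       = ⊥
fromList (u ∷ us) = fromList us [ u ]≔ inside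

∈-insert⁻ : ∀ {n} (S : Subset n) u {v} → v ∈ S [ u ]≔ inside → v ≡ u ⊎ v ∈ S
∈-insert⁻ (_ ∷ S) zero    here      = inj₁ refl
∈-insert⁻ (_ ∷ S) zero    (there p) = inj₂ (there p)
∈-insert⁻ (_ ∷ S) (suc u) here      = inj₂ here
∈-insert⁻ (_ ∷ S) (suc u) (there p) with ∈-insert⁻ S u p
... | inj₁ refl = inj₁ refl
... | inj₂ q    = inj₂ (there q)

∈-fromList⁻ : ∀ {n} (us : List (Fin n)) {v} → v ∈ fromList us → v List.∈ us
∈-fromList⁻ []       p = ⊥-elim (Subset.∉⊥ p)
∈-fromList⁻ (u ∷ us) p with ∈-insert⁻ (fromList us) u p
... | inj₁ eq = here eq
... | inj₂ q  = there (∈-fromList⁻ us q)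

∣insert∣ : ∀ {n} (S : Subset n) u → ¬ (u ∈ S) → ∣ S [ u ]≔ inside ∣ ≡ suc ∣ S ∣
∣insert∣ (true ∷ S)  zero    u∉ = ⊥-elim (u∉ here)
∣insert∣ (false ∷ S) zero    u∉ = refl
∣insert∣ (true ∷ S)  (suc u) u∉ = cong suc (∣insert∣ S u λ p → u∉ (there p))
∣insert∣ (false ∷ S) (suc u) u∉ = ∣insert∣ S u λ p → u∉ (there p)

∣fromList∣ : ∀ {n} {us : List (Fin n)} → Unique us → ∣ fromList us ∣ ≡ length us
∣fromList∣ {n} {[]}     []       = Subset.∣⊥∣≡0 n
∣fromList∣ {us = u ∷ us} (u∉ ∷ p) =
  trans (∣insert∣ (fromList us) u λ u∈ → All.lookup u∉ (∈-fromList⁻ us u∈) refl)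
        (cong suc (∣fromList∣ p))

toList : ∀ {n} → Subset n → List (Fin n)
toList []          = []
toList (true ∷ S)  = zero ∷ map suc (toList S)
toList (false ∷ S) = map suc (toList S)

length-toList : ∀ {n} (S : Subset n) → length (toList S) ≡ ∣ S ∣
length-toList []          = refl
length-toList (true ∷ S)  = cong suc (trans (List.length-map suc (toList S)) (length-toList S))
length-toList (false ∷ S) = trans (List.length-map suc (toList S)) (length-toList S)

∈-toList⁻ : ∀ {n} (S : Subset n) {v} → v List.∈ toList S → v ∈ S
∈-toList⁻ (true ∷ S) (here refl) = here
∈-toList⁻ (true ∷ S) (there p) with ∈-map⁻ suc p
... | _ , q , refl = there (∈-toList⁻ S q)
∈-toList⁻ (false ∷ S) p with ∈-map⁻ suc p
... | _ , q , refl = there (∈-toList⁻ S q)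

toList-unique : ∀ {n} (S : Subset n) → Unique (toList S)
toList-unique []          = []
toList-unique (true ∷ S)  = All.map⁺ (All.tabulate λ _ ()) ∷ Unique.map⁺ suc-injective (toList-unique S)
toList-unique (false ∷ S) = Unique.map⁺ suc-injective (toList-unique S)

-- The order of Dedekind cuts and the embedding of the rationals

open ℝ
open Equivalence

L-downward : ∀ x {p q} → p <ℚ q → L x q → L x p
L-downward x p<q l = from (L-rounded x _) (_ , p<q , l)

-- Locatedness of `x` between two members of the lower cut of `y` replaces trichotomy: if the larger
-- one were an upper bound of `x`, then `x ≤ℝ y` would follow.
≰ℝ⇒≥ℝ : ∀ x y → ¬ (x ≤ℝ y) → y ≤ℝ x
≰ℝ⇒≥ℝ x y x≰y q ly with to (L-rounded y q) ly
... | q′ , q<q′ , ly′ with located x q q′ q<q′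
...   | inj₁ lx = lx
...   | inj₂ ux = ⊥-elim (x≰y λ p lx → case p lx)
  where
  case : ∀ p → L x p → L y p
  case p lx with ℚ.<-cmp p q′
  ... | tri< p<q′ _ _ = L-downward y p<q′ ly′
  ... | tri≈ _ refl _ = ly′
  ... | tri> _ _ q′<p = ⊥-elim (disjoint x q′ (L-downward x q′<p lx , ux))

≤ℝ-refl : ∀ x → x ≤ℝ x
≤ℝ-refl x q l = l

+1-mono : ∀ x y → x ≤ℝ y → (x +1) ≤ℝ (y +1)
+1-mono x y x≤y q = x≤y (q -ℚ 1ℚ)

q-1<q : ∀ q → q -ℚ 1ℚ <ℚ q
q-1<q q = subst (q -ℚ 1ℚ <ℚ_) (ℚ.+-identityʳ q) (ℚ.+-monoʳ-< q {(-ℚ 1ℚ)} {0ℚ} (ℚ.negative⁻¹ _))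

x≤x+1 : ∀ x → x ≤ℝ (x +1)
x≤x+1 x q = L-downward x (q-1<q q)

fromℚ : ℚ → ℝ
fromℚ q = record
  { L = _<ℚ q
  ; U = q <ℚ_
  ; L-inhabited = q -ℚ 1ℚ , q-1<q q
  ; U-inhabited = q +ℚ 1ℚ , subst (_<ℚ q +ℚ 1ℚ) (ℚ.+-identityʳ q) (ℚ.+-monoʳ-< q (ℚ.positive⁻¹ 1ℚ))
  ; L-rounded = λ r → mk⇔ (λ r<q → let m , a , b = ℚ.<-dense r<q in m , a , b) (λ (_ , a , b) → ℚ.<-trans a b)
  ; U-rounded = λ r → mk⇔ (λ q<r → let m , a , b = ℚ.<-dense q<r in m , b , a) (λ (_ , a , b) → ℚ.<-trans b a)
  ; disjoint = λ r (a , b) → ℚ.<-asym a b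
  ; located = λ r s r<s → located′ r s r<s
  }
  where
  located′ : ∀ r s → r <ℚ s → r <ℚ q ⊎ q <ℚ s
  located′ r s r<s with r ℚ.<? q
  ... | yes r<q = inj₁ r<q
  ... | no  r≮q = inj₂ (ℚ.≤-<-trans (ℚ.≮⇒≥ r≮q) r<s)

fromℚ-mono : ∀ {p q} → p ≤ℚ q → fromℚ p ≤ℝ fromℚ q
fromℚ-mono p≤q r r<p = ℚ.<-≤-trans r<p p≤q

fromℚ-mono-+1 : ∀ {p q} → p ≤ℚ q +ℚ 1ℚ → fromℚ p ≤ℝ (fromℚ q +1)
fromℚ-mono-+1 {p} {q} p≤q+1 r r<p = subst (r -ℚ 1ℚ <ℚ_)
  (trans (ℚ.+-assoc q 1ℚ _) (ℚ.+-identityʳ q)) (ℚ.+-monoˡ-< (-ℚ 1ℚ) (ℚ.<-≤-trans r<p p≤q+1))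

-- If q + 1 were below p, the hypothesis could be applied to q + 1 itself and would give q < q.
fromℚ-cancel-+1 : ∀ {p q} → fromℚ p ≤ℝ (fromℚ q +1) → p ≤ℚ q +ℚ 1ℚ
fromℚ-cancel-+1 {p} {q} h = ℚ.≮⇒≥ λ q+1<p →
  ℚ.<-irrefl refl (subst (_<ℚ q) (trans (ℚ.+-assoc q 1ℚ _) (ℚ.+-identityʳ q)) (h _ q+1<p))


-- Unit interval graphs with left ends over a common denominator

module _ (d : ℕ) where
  private
    D : ℕ
    D = suc d

  -- `_/_` reduces to lowest terms, so numerators over the common denominator are compared through
  -- unnormalised rationals.
  toℚᵘ-/ : ∀ i → toℚᵘ (i / D) ≃ mkℚᵘ i d
  toℚᵘ-/ i = ℚ.toℚᵘ-fromℚᵘ (mkℚᵘ i d)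

  /-mono : ∀ {m n} → m ≤ n → + m / D ≤ℚ + n / D
  /-mono {m} {n} m≤n = ℚ.toℚᵘ-cancel-≤ (ℚᵘ.≤-respˡ-≃ (ℚᵘ.≃-sym (toℚᵘ-/ (+ m)))
    (ℚᵘ.≤-respʳ-≃ (ℚᵘ.≃-sym (toℚᵘ-/ (+ n))) (*≤*ᵘ (ℤ.*-monoʳ-≤-nonNeg (+ D) (+≤+ m≤n)))))

  /-cancel : ∀ {m n} → + m / D ≤ℚ + n / D → m ≤ n
  /-cancel {m} {n} h
    with ℚᵘ.≤-respˡ-≃ (toℚᵘ-/ (+ m)) (ℚᵘ.≤-respʳ-≃ (toℚᵘ-/ (+ n)) (ℚ.toℚᵘ-mono-≤ h))
  ... | *≤*ᵘ p = ℤ.drop‿+≤+ (ℤ.*-cancelʳ-≤-pos (+ m) (+ n) (+ D) p)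

  /-+1 : ∀ n → + n / D +ℚ 1ℚ ≡ + (n + D) / D
  /-+1 n = ℚ.toℚᵘ-injective (ℚᵘ.≃-trans (ℚ.toℚᵘ-homo-+ (+ n / D) 1ℚ)
    (ℚᵘ.≃-trans (ℚᵘ.+-congˡ 1ℚᵘ (toℚᵘ-/ (+ n))) (ℚᵘ.≃-trans eq (ℚᵘ.≃-sym (toℚᵘ-/ (+ (n + D)))))))
    where
    eq : mkℚᵘ (+ n) d +ᵘ 1ℚᵘ ≃ mkℚᵘ (+ (n + D)) d
    eq = *≡* (cong₂ ℤ._*_ (cong₂ ℤ._+_ (ℤ.*-identityʳ (+ n)) (ℤ.*-identityˡ (+ D))) (cong +_ (sym (ℕ.*-identityʳ D))))

  -- The vertex u stands for the interval [ pos u / D , pos u / D + 1 ].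
  posGraph : ∀ {n} → (Fin n → ℕ) → Graph n
  posGraph pos = record
    { Adj    = λ u v → u ≢ v × pos u ≤ pos v + D × pos v ≤ pos u + D
    ; adj?   = λ u v → ¬? (u Fin.≟ v) ×-dec pos u ℕ.≤? pos v + D ×-dec pos v ℕ.≤? pos u + D
    ; irrefl = λ v (v≢v , _) → v≢v refl
    ; symm   = λ (u≢v , a , b) → ≢-sym u≢v , b , a
    }

  posGraph-unit : ∀ {n} (pos : Fin n → ℕ) → UnitInterval (posGraph pos)
  posGraph-unit {n} pos = (λ u → real (pos u)) , λ u v → mk⇔ (to′ u v) (from′ u v)
    where
    real : ℕ → ℝ
    real m = fromℚ (+ m / D)

    ≤+1 : ∀ {k m} → k ≤ m + D → real k ≤ℝ (real m +1)
    ≤+1 {k} {m} h = fromℚ-mono-+1 (subst (+ k / D ≤ℚ_) (sym (/-+1 m)) (/-mono h))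

    to′ : ∀ u v → u ≢ v × pos u ≤ pos v + D × pos v ≤ pos u + D →
          u ≢ v × ∃ λ x → x ∈[ real (pos u) , real (pos u) +1] × x ∈[ real (pos v) , real (pos v) +1]
    -- The larger of the two left ends is the common point.
    to′ u v (u≢v , a , b) with ℕ.≤-total (pos u) (pos v)
    ... | inj₁ u≤v = u≢v , real (pos v) , (fromℚ-mono (/-mono u≤v) , ≤+1 b) , (≤ℝ-refl (real (pos v)) , x≤x+1 (real (pos v)))
    ... | inj₂ v≤u = u≢v , real (pos u) , (≤ℝ-refl (real (pos u)) , x≤x+1 (real (pos u))) , (fromℚ-mono (/-mono v≤u) , ≤+1 a)

    from′ : ∀ u v → u ≢ v × (∃ λ x → x ∈[ real (pos u) , real (pos u) +1] × x ∈[ real (pos v) , real (pos v) +1]) →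
            u ≢ v × pos u ≤ pos v + D × pos v ≤ pos u + D
    from′ u v (u≢v , x , (ux , xu) , (vx , xv)) = u≢v , bound (λ q l → xv q (ux q l)) , bound (λ q l → xu q (vx q l))
      where
      bound : ∀ {k m} → real k ≤ℝ (real m +1) → k ≤ m + D
      bound {k} {m} h = /-cancel (subst (+ k / D ≤ℚ_) (/-+1 m) (fromℚ-cancel-+1 h))

-- Degrees in unit interval graphs and the upper bound for FirstFit

unique-related⇒allPairs : ∀ {a q r} {A : Set a} {Q : A → Set q} {R : A → A → Set r} →
                          (∀ {x y} → x ≢ y → Q x → Q y → R x y) →
                          ∀ {xs} → Unique xs → All Q xs → AllPairs R xs
unique-related⇒allPairs rel []       []       = []
unique-related⇒allPairs rel (x∉ ∷ u) (q ∷ qs) =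
  All.zipWith (λ (x≢y , qy) → rel x≢y q qy) (x∉ , qs) ∷ unique-related⇒allPairs rel u qs

allPairs-lookup : ∀ {a r} {A : Set a} {R : A → A → Set r} → (∀ {x y} → R x y → R y x) →
                  ∀ {xs} → AllPairs R xs → ∀ {x y} → x List.∈ xs → y List.∈ xs → x ≢ y → R x y
allPairs-lookup sy (r ∷ rs) (here refl) (here refl) x≢y = ⊥-elim (x≢y refl)
allPairs-lookup sy (r ∷ rs) (here refl) (there q)   x≢y = All.lookup r q
allPairs-lookup sy (r ∷ rs) (there p)   (here refl) x≢y = sy (All.lookup r p)
allPairs-lookup sy (r ∷ rs) (there p)   (there q)   x≢y = allPairs-lookup sy rs p q x≢y

length-filter-¬ : ∀ {a p} {A : Set a} {P : A → Set p} (P? : Decidable P) xs →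
                  length xs ≡ length (filter P? xs) + length (filter (λ x → ¬? (P? x)) xs)
length-filter-¬ P? []       = refl
length-filter-¬ P? (x ∷ xs) with P? x
... | yes _ = cong suc (length-filter-¬ P? xs)
... | no  _ = trans (cong suc (length-filter-¬ P? xs)) (sym (ℕ.+-suc _ _))

module _ {n} (G : Graph n) where
  open Graph G

  adj⇒unique : ∀ {us} → AllPairs Adj us → Unique us
  adj⇒unique = AllPairs.map λ {u} a u≡v → irrefl u (subst (Adj u) (sym u≡v) a)

  fromList-clique : ∀ {us} → AllPairs Adj us → Clique G (fromList us)
  fromList-clique {us} ps u v u∈ v∈ u≢v =
    allPairs-lookup symm ps (∈-fromList⁻ us u∈) (∈-fromList⁻ us v∈) u≢v

  module _ {d} (unit : UnitInterval G) (ω≤ : ∀ S → Clique G S → ∣ S ∣ ≤ suc d) where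
    private left = proj₁ unit

    clique-length : ∀ {us} → AllPairs Adj us → length us ≤ suc d
    clique-length {us} ps = subst (_≤ suc d) (∣fromList∣ (adj⇒unique ps)) (ω≤ (fromList us) (fromList-clique ps))

    left-right : ∀ {u v} → Adj u v → left u ≤ℝ (left v +1)
    left-right a with to (proj₂ unit _ _) a
    ... | _ , x , (ux , _) , (_ , xv) = λ q l → xv q (ux q l)

    -- Intervals starting to the left of v all contain the left end of v, the
    -- others all contain its right end.
    degree-bound : ∀ v {us} → Unique us → All (Adj v) us → length us ≤ d + d
    degree-bound v {us} uniq adj = decidable-stable (_ ℕ.≤? _) λ ¬bound →
      Fin.sequence (RawMonad.rawApplicative ¬¬-Monad) (λ u → ¬¬-excluded-middle) λ left? →
        ¬bound (bound left?)
      where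
      bound : (∀ u → Dec (left u ≤ℝ left v)) → length us ≤ d + d
      bound left? = subst (_≤ d + d) (sym (length-filter-¬ left? us))
        (ℕ.+-mono-≤ (clique left? λ u≢w (a , u≤v) (b , w≤v) →
            from (proj₂ unit _ _) (u≢w , left v , (u≤v , left-right a) , (w≤v , left-right b)))
          (clique (λ u → ¬? (left? u)) λ {u} {w} u≢w (a , u≰v) (b , w≰v) →
            from (proj₂ unit _ _) (u≢w , (left v +1) ,
              (left-right (symm a) , +1-mono (left v) (left u) (≰ℝ⇒≥ℝ (left u) (left v) u≰v)) ,
              (left-right (symm b) , +1-mono (left v) (left w) (≰ℝ⇒≥ℝ (left w) (left v) w≰v)))))
        where
        clique : ∀ {P : Fin n → Set} (P? : Decidable P) →
                 (∀ {u w} → u ≢ w → Adj v u × P u → Adj v w × P w → Adj u w) →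
                 length (filter P? us) ≤ d
        clique P? rel = ℕ.≤-pred (clique-length
          (All.filter⁺ P? adj ∷
           unique-related⇒allPairs rel (Unique.filter⁺ P? uniq)
             (All.zip (All.filter⁺ P? adj , All.all-filter P? us))))

-- All positive numbers below the least free one occur in `cs`, so there are at most `length cs` of
-- them.
leastFree-≤ : ∀ cs → leastFree cs ≤ suc (length cs)
leastFree-≤ cs with leastFree cs | leastFree-spec cs
... | suc c | _ , _ , below =
  s≤s (ℕ.≤-trans (≤-distinct λ k 1≤k k≤c → below k 1≤k (s≤s k≤c)) (List.length-deduplicate ℕ._≟_ cs))

module _ {n} (G : Graph n) where
  open Graph G

  -- Each new colour exceeds the number of coloured neighbours by at most 1. Uniqueness and
  -- freshness keep the processed vertices distinct, so that the degree bound applies to these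
  -- neighbours.
  firstFit-bound : ∀ {k} → (∀ v {us} → Unique us → All (Adj v) us → length us ≤ k) →
                   ∀ done σ → Unique (map proj₁ done) → Unique σ →
                   (∀ {v} → v List.∈ σ → ¬ v List.∈ map proj₁ done) →
                   All (λ (_ , c) → 1 ≤ c × c ≤ suc k) done →
                   All (λ (_ , c) → 1 ≤ c × c ≤ suc k) (foldl (colourNext G) done σ)
  firstFit-bound deg done []      ud uσ fresh b = b
  firstFit-bound {k} deg done (v ∷ σ) ud (v∉ ∷ uσ) fresh b =
    firstFit-bound deg (colourNext G done v) σ
      (All.tabulate (λ p v≡ → fresh (here refl) (subst (List._∈ _) (sym v≡) p)) ∷ ud)
      uσ
      (λ { p (here refl) → All.lookup v∉ p refl ; p (there q) → fresh (there p) q })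
      ((proj₁ (leastFree-spec cs) , ℕ.≤-trans (leastFree-≤ cs) (s≤s
        (subst (_≤ k) (trans (List.length-map proj₁ nbrs) (sym (List.length-map proj₂ nbrs)))
          (deg v (AllPairs.map⁺ (AllPairs.filter⁺ _ (AllPairs.map⁻ ud)))
                 (All.map⁺ (All.all-filter _ done)))))) ∷ b)
    where
    nbrs = filter (λ uc → adj? v (proj₁ uc)) done
    cs = map proj₂ nbrs

  coloursUsed-≤ : ∀ {k} → (∀ v {us} → Unique us → All (Adj v) us → length us ≤ k) →
                  ∀ {σ} → Unique σ → coloursUsed G σ ≤ suc k
  coloursUsed-≤ deg {σ} uσ = distinct-≤ (All.map⁺ (firstFit-bound deg [] σ [] uσ (λ _ ()) []))

-- FirstFit on a part of a graph without edges to the rest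

module _ {n n′} (G : Graph n) (K : Graph n′) (ρ : Fin n′ → Maybe (Fin n))
         (preserves : ∀ {w x u y} → ρ w ≡ just u → ρ x ≡ just y → Graph.Adj K w x ⇔ Graph.Adj G u y)
         (closed : ∀ {w x u} → ρ w ≡ just u → ρ x ≡ nothing → ¬ Graph.Adj K w x) where

  private
    module G = Graph G
    module K = Graph K

    ρ′ : Fin n′ × ℕ → Maybe (Fin n × ℕ)
    ρ′ (v , c) = Maybe.map (_, c) (ρ v)

    nbr-colours : ∀ {w u} → ρ w ≡ just u → ∀ done →
                  map proj₂ (filter (λ uc → G.adj? u (proj₁ uc)) (mapMaybe ρ′ done)) ≡
                  map proj₂ (filter (λ uc → K.adj? w (proj₁ uc)) done)
    nbr-colours eq [] = refl
    nbr-colours {w} {u} eq ((x , c) ∷ done) with ρ x in eqx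
    ... | nothing with K.adj? w x
    ...   | yes a = ⊥-elim (closed eq eqx a)
    ...   | no  _ = nbr-colours eq done
    nbr-colours {w} {u} eq ((x , c) ∷ done) | just y with K.adj? w x | G.adj? u y
    ...   | yes _ | yes _ = cong (c ∷_) (nbr-colours eq done)
    ...   | no  _ | no  _ = nbr-colours eq done
    ...   | yes a | no  b = ⊥-elim (b (to (preserves eq eqx) a))
    ...   | no  a | yes b = ⊥-elim (a (from (preserves eq eqx) b))

    -- By `closed`, a vertex in the domain of `ρ` has all its neighbours there, so vertices outside
    -- never influence its colour.
    firstFit-restrict : ∀ done σ → foldl (colourNext G) (mapMaybe ρ′ done) (mapMaybe ρ σ) ≡
                                   mapMaybe ρ′ (foldl (colourNext K) done σ)
    firstFit-restrict done [] = refl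
    firstFit-restrict done (w ∷ σ) with ρ w in eq | firstFit-restrict (colourNext K done w) σ
    ... | nothing | ih = ih
    ... | just u  | ih = trans (cong (λ cs → foldl (colourNext G) ((u , leastFree cs) ∷ mapMaybe ρ′ done) (mapMaybe ρ σ))
                                  (nbr-colours eq done)) ih

    colour-∈ : ∀ {c} xs → c List.∈ map proj₂ (mapMaybe ρ′ xs) → c List.∈ map proj₂ xs
    colour-∈ ((x , c) ∷ xs) p with ρ x
    ... | nothing = there (colour-∈ xs p)
    colour-∈ ((x , c) ∷ xs) (here eq) | just y = here eq
    colour-∈ ((x , c) ∷ xs) (there p) | just y = there (colour-∈ xs p)

  coloursUsed-restrict : ∀ σ → coloursUsed G (mapMaybe ρ σ) ≤ coloursUsed K σ
  coloursUsed-restrict σ = distinct-mono λ {c} c∈ →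
    colour-∈ (firstFit K σ) (subst (λ xs → c List.∈ map proj₂ xs) (firstFit-restrict [] σ) c∈)

-- Shuffles and the orderings of a disjoint union

shuffles : ∀ {a} {A B : Set a} → List A → List B → List (List (A ⊎ B))
shuffles []       ys       = map inj₂ ys ∷ []
shuffles (x ∷ xs) []       = map inj₁ (x ∷ xs) ∷ []
shuffles (x ∷ xs) (y ∷ ys) = map (inj₁ x ∷_) (shuffles xs (y ∷ ys)) ++ map (inj₂ y ∷_) (shuffles (x ∷ xs) ys)

∈-shuffles : ∀ {a} {A B : Set a} (τ : List (A ⊎ B)) →
             τ List.∈ shuffles (mapMaybe isInj₁ τ) (mapMaybe isInj₂ τ)
∈-shuffles [] = here refl
∈-shuffles (inj₁ x ∷ τ) with mapMaybe isInj₁ τ | mapMaybe isInj₂ τ | ∈-shuffles τ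
... | []     | []     | here eq = here (cong (inj₁ x ∷_) eq)
... | _ ∷ _  | []     | here eq = here (cong (inj₁ x ∷_) eq)
... | _      | _ ∷ _  | p       = ∈-++⁺ˡ (∈-map⁺ _ p)
∈-shuffles (inj₂ y ∷ τ) with mapMaybe isInj₁ τ | mapMaybe isInj₂ τ | ∈-shuffles τ
... | []     | _      | here eq = here (cong (inj₂ y ∷_) eq)
... | x ∷ xs | ys     | p       = ∈-++⁺ʳ (map (inj₁ x ∷_) (shuffles xs (y ∷ ys))) (∈-map⁺ _ p)

-- The number of shuffles is a binomial coefficient, here with its denominator multiplied out; the
-- recursion of `shuffles` is Pascal's rule.
length-shuffles : ∀ {a} {A B : Set a} (xs : List A) (ys : List B) →
                  length (shuffles xs ys) * (length xs ! * length ys !) ≡ (length xs + length ys) !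
length-shuffles []       ys = trans (ℕ.*-identityˡ _) (ℕ.*-identityˡ _)
length-shuffles (x ∷ xs) [] = trans (ℕ.*-identityˡ _) (trans (ℕ.*-identityʳ _) (cong (λ k → suc k !) (sym (ℕ.+-identityʳ (length xs)))))
length-shuffles (x ∷ xs) (y ∷ ys) = begin
  length (shuffles (x ∷ xs) (y ∷ ys)) * (suc a ! * suc b !)
    ≡⟨ cong (_* (suc a ! * suc b !)) (trans (List.length-++ (map (inj₁ x ∷_) (shuffles xs (y ∷ ys))))
         (cong₂ _+_ (List.length-map _ (shuffles xs (y ∷ ys))) (List.length-map _ (shuffles (x ∷ xs) ys)))) ⟩
  (p + q) * (suc a ! * suc b !)
    ≡⟨ rearrange p q a b (a !) (b !) ⟩
  suc a * (p * (a ! * suc b !)) + suc b * (q * (suc a ! * b !))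
    ≡⟨ cong₂ (λ s t → suc a * s + suc b * t) (length-shuffles xs (y ∷ ys)) (length-shuffles (x ∷ xs) ys) ⟩
  suc a * (a + suc b) ! + suc b * (suc a + b) !
    ≡⟨ cong (λ k → suc a * (a + suc b) ! + suc b * k !) (sym (ℕ.+-suc a b)) ⟩
  suc a * (a + suc b) ! + suc b * (a + suc b) !
    ≡⟨ ℕ.*-distribʳ-+ ((a + suc b) !) (suc a) (suc b) ⟨
  (suc a + suc b) ! ∎
  where
  open ≡-Reasoning
  a = length xs
  b = length ys
  p = length (shuffles xs (y ∷ ys))
  q = length (shuffles (x ∷ xs) ys)
  rearrange : ∀ p q a b f g → (p + q) * ((1 + a) * f * ((1 + b) * g)) ≡
              (1 + a) * (p * (f * ((1 + b) * g))) + (1 + b) * (q * ((1 + a) * f * g))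
  rearrange = solve-∀

-- The number of shuffles is known only after multiplication by factorials; the factor `k` carries
-- them through the sum.
length-concatMap-* : ∀ {a b} {A : Set a} {B : Set b} (f : A → List B) {k m} xs →
                     (∀ {x} → x List.∈ xs → length (f x) * k ≡ m) →
                     length (concatMap f xs) * k ≡ length xs * m
length-concatMap-* f []       eqs = refl
length-concatMap-* f {k} {m} (x ∷ xs) eqs = begin
  length (f x ++ concatMap f xs) * k            ≡⟨ cong (_* k) (List.length-++ (f x)) ⟩
  (length (f x) + length (concatMap f xs)) * k  ≡⟨ ℕ.*-distribʳ-+ k (length (f x)) _ ⟩
  length (f x) * k + length (concatMap f xs) * k
    ≡⟨ cong₂ _+_ (eqs (here refl)) (length-concatMap-* f xs λ p → eqs (there p)) ⟩
  m + length xs * m ∎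
  where open ≡-Reasoning

tabulate-+ : ∀ {a} {A : Set a} n {m} (f : Fin (n + m) → A) →
             tabulate f ≡ tabulate (λ i → f (i ↑ˡ m)) ++ tabulate (λ j → f (n ↑ʳ j))
tabulate-+ zero    f = refl
tabulate-+ (suc n) f = cong (f zero ∷_) (tabulate-+ n (λ i → f (suc i)))

allFin-splitAt : ∀ n m → map (splitAt n) (allFin (n + m)) ≡ map inj₁ (allFin n) ++ map inj₂ (allFin m)
allFin-splitAt n m = begin
  map (splitAt n) (allFin (n + m))   ≡⟨ List.map-tabulate (λ i → i) (splitAt n) ⟩
  tabulate (splitAt n {m})           ≡⟨ tabulate-+ n (splitAt n) ⟩
  tabulate (λ i → splitAt n (i ↑ˡ m)) ++ tabulate (λ j → splitAt n (n ↑ʳ j))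
    ≡⟨ cong₂ _++_ (List.tabulate-cong λ i → Fin.splitAt-↑ˡ n i m) (List.tabulate-cong λ j → Fin.splitAt-↑ʳ n m j) ⟩
  tabulate inj₁ ++ tabulate inj₂
    ≡⟨ cong₂ _++_ (List.map-tabulate (λ i → i) inj₁) (List.map-tabulate (λ i → i) inj₂) ⟨
  map inj₁ (allFin n) ++ map inj₂ (allFin m) ∎
  where open ≡-Reasoning

-- Here "bad" means bad for the lower bound. The overview uses the word for the opposite kind of
-- ordering, the one on which FirstFit needs many colours.
badOrderings : ∀ {n} → Graph n → ℕ → List (List (Fin n))
badOrderings {n} G k = filter (λ σ → coloursUsed G σ ℕ.<? k) (orderings n)

module _ {n m} (G : Graph n) (H : Graph m) (K : Graph (n + m)) where
  private
    module G = Graph G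
    module H = Graph H
    module K = Graph K

  record IsDisjointUnion : Set where
    field
      left  : ∀ {w x u y} → splitAt n w ≡ inj₁ u → splitAt n x ≡ inj₁ y → K.Adj w x ⇔ G.Adj u y
      right : ∀ {w x u y} → splitAt n w ≡ inj₂ u → splitAt n x ≡ inj₂ y → K.Adj w x ⇔ H.Adj u y
      cross : ∀ {w x u y} → splitAt n w ≡ inj₁ u → splitAt n x ≡ inj₂ y → ¬ K.Adj w x

  module _ (union : IsDisjointUnion) (k : ℕ) where
    open IsDisjointUnion union

    private
      ρ₁ : Fin (n + m) → Maybe (Fin n)
      ρ₁ = isInj₁ ∘ splitAt n

      ρ₂ : Fin (n + m) → Maybe (Fin m)
      ρ₂ = isInj₂ ∘ splitAt n

      just₁ : ∀ {w u} → ρ₁ w ≡ just u → splitAt n w ≡ inj₁ u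
      just₁ {w} eq with splitAt n w | eq
      ... | inj₁ _ | refl = refl

      just₂ : ∀ {w u} → ρ₂ w ≡ just u → splitAt n w ≡ inj₂ u
      just₂ {w} eq with splitAt n w | eq
      ... | inj₂ _ | refl = refl

      nothing₁ : ∀ {w} → ρ₁ w ≡ nothing → ∃ λ u → splitAt n w ≡ inj₂ u
      nothing₁ {w} eq with splitAt n w | eq
      ... | inj₂ u | _ = u , refl

      nothing₂ : ∀ {w} → ρ₂ w ≡ nothing → ∃ λ u → splitAt n w ≡ inj₁ u
      nothing₂ {w} eq with splitAt n w | eq
      ... | inj₁ u | _ = u , refl

      coloursUsed₁ : ∀ σ → coloursUsed G (mapMaybe ρ₁ σ) ≤ coloursUsed K σ
      coloursUsed₁ = coloursUsed-restrict G K ρ₁ (λ p q → left (just₁ p) (just₁ q))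
        (λ p q → cross (just₁ p) (proj₂ (nothing₁ q)))

      coloursUsed₂ : ∀ σ → coloursUsed H (mapMaybe ρ₂ σ) ≤ coloursUsed K σ
      coloursUsed₂ = coloursUsed-restrict H K ρ₂ (λ p q → right (just₂ p) (just₂ q))
        (λ p q a → cross (proj₂ (nothing₂ q)) (just₂ p) (K.symm a))

      restrict₁ : ∀ {σ} → σ ↭ allFin (n + m) → mapMaybe ρ₁ σ ↭ allFin n
      restrict₁ p = ↭-trans (mapMaybe-↭ ρ₁ p) (↭-reflexive (begin
        mapMaybe ρ₁ (allFin (n + m))
          ≡⟨ List.mapMaybe-map isInj₁ (splitAt n) (allFin (n + m)) ⟨
        mapMaybe isInj₁ (map (splitAt n) (allFin (n + m)))
          ≡⟨ cong (mapMaybe isInj₁) (allFin-splitAt n m) ⟩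
        mapMaybe isInj₁ (map inj₁ (allFin n) ++ map inj₂ (allFin m))
          ≡⟨ List.mapMaybe-++ isInj₁ (map inj₁ (allFin n)) _ ⟩
        mapMaybe isInj₁ (map inj₁ (allFin n)) ++ mapMaybe isInj₁ (map inj₂ (allFin m))
          ≡⟨ cong₂ _++_ (List.mapMaybeIsInj₁∘mapInj₁ (allFin n)) (List.mapMaybeIsInj₁∘mapInj₂ (allFin m)) ⟩
        allFin n ++ []
          ≡⟨ List.++-identityʳ _ ⟩
        allFin n ∎))
        where open ≡-Reasoning

      restrict₂ : ∀ {σ} → σ ↭ allFin (n + m) → mapMaybe ρ₂ σ ↭ allFin m
      restrict₂ p = ↭-trans (mapMaybe-↭ ρ₂ p) (↭-reflexive (begin
        mapMaybe ρ₂ (allFin (n + m))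
          ≡⟨ List.mapMaybe-map isInj₂ (splitAt n) (allFin (n + m)) ⟨
        mapMaybe isInj₂ (map (splitAt n) (allFin (n + m)))
          ≡⟨ cong (mapMaybe isInj₂) (allFin-splitAt n m) ⟩
        mapMaybe isInj₂ (map inj₁ (allFin n) ++ map inj₂ (allFin m))
          ≡⟨ List.mapMaybe-++ isInj₂ (map inj₁ (allFin n)) _ ⟩
        mapMaybe isInj₂ (map inj₁ (allFin n)) ++ mapMaybe isInj₂ (map inj₂ (allFin m))
          ≡⟨ cong₂ _++_ (List.mapMaybeIsInj₂∘mapInj₁ (allFin n)) (List.mapMaybeIsInj₂∘mapInj₂ (allFin m)) ⟩
        allFin m ∎))
        where open ≡-Reasoning

      merges : List (List (Fin n ⊎ Fin m))
      merges = concatMap (λ as → concatMap (shuffles as) (badOrderings H k)) (badOrderings G k)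

      restriction-bad : ∀ {σ} → σ List.∈ badOrderings K k →
                        mapMaybe ρ₁ σ List.∈ badOrderings G k × mapMaybe ρ₂ σ List.∈ badOrderings H k
      restriction-bad {σ} σ∈ with ∈-filter⁻ (λ σ → coloursUsed K σ ℕ.<? k) {xs = orderings (n + m)} σ∈
      ... | p , bad =
        ∈-filter⁺ _ (from (∈-orderings n _) (restrict₁ σ↭)) (ℕ.≤-<-trans (coloursUsed₁ σ) bad) ,
        ∈-filter⁺ _ (from (∈-orderings m _) (restrict₂ σ↭)) (ℕ.≤-<-trans (coloursUsed₂ σ) bad)
        where σ↭ = to (∈-orderings (n + m) σ) p

      bad⊆merges : ∀ {σ} → σ List.∈ badOrderings K k → σ List.∈ map (map (join n m)) merges
      bad⊆merges {σ} σ∈ = subst (List._∈ _)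
        (trans (sym (List.map-∘ σ)) (trans (List.map-cong (Fin.join-splitAt n m) σ) (List.map-id σ)))
        (∈-map⁺ _ (∈-concatMap⁺ _ (lose (proj₁ (restriction-bad σ∈))
          (∈-concatMap⁺ _ (lose (proj₂ (restriction-bad σ∈)) shuffled)))))
        where
        shuffled : map (splitAt n) σ List.∈ shuffles (mapMaybe ρ₁ σ) (mapMaybe ρ₂ σ)
        shuffled = subst₂ (λ as bs → map (splitAt n) σ List.∈ shuffles as bs)
          (List.mapMaybe-map isInj₁ (splitAt n) σ) (List.mapMaybe-map isInj₂ (splitAt n) σ)
          (∈-shuffles (map (splitAt n) σ))

      length-bad : ∀ {l} (L : Graph l) {σ} → σ List.∈ badOrderings L k → length σ ≡ l
      length-bad {l} L σ∈ = trans
        (↭-length (to (∈-orderings l _) (proj₁ (∈-filter⁻ (λ σ → coloursUsed L σ ℕ.<? k) {xs = orderings l} σ∈))))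
        (List.length-tabulate (λ i → i))

      length-merges : length merges * (n ! * m !) ≡
                      length (badOrderings G k) * (length (badOrderings H k) * (n + m) !)
      length-merges = length-concatMap-* _ (badOrderings G k) λ {as} a∈ →
        length-concatMap-* (shuffles as) (badOrderings H k) λ {bs} b∈ →
          subst₂ (λ i j → length (shuffles as bs) * (i ! * j !) ≡ (i + j) !)
            (length-bad G a∈) (length-bad H b∈) (length-shuffles as bs)

    -- After division by the factorials: the fraction of bad orderings of the union is at most the
    -- product of the fractions for the parts. Restricting an ordering to a part never increases the
    -- number of colours, so a bad ordering of the union is a shuffle of two bad ones.
    bad-union : length (badOrderings K k) * (n ! * m !) ≤
                length (badOrderings G k) * (length (badOrderings H k) * (n + m) !)
    bad-union = subst (length (badOrderings K k) * (n ! * m !) ≤_) length-merges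
      (ℕ.*-monoˡ-≤ (n ! * m !) (subst (length (badOrderings K k) ≤_) (List.length-map _ merges)
        (unique-⊆⇒length-≤ (Unique.filter⁺ _ (orderings-unique (n + m))) bad⊆merges)))

bad≤! : ∀ {n} (G : Graph n) k → length (badOrderings G k) ≤ n !
bad≤! {n} G k = subst (length (badOrderings G k) ≤_) (length-orderings n) (List.length-filter _ (orderings n))

-- Graphs with a certified clique number, and many disjoint copies

module _ {n} (G : Graph n) where
  open Graph G

  -- A proper colouring is injective on a clique.
  colouring⇒clique-≤ : ∀ {ω} (h : Fin n → ℕ) → (∀ v → h v < ω) → (∀ {u v} → Adj u v → h u ≢ h v) →
                       ∀ S → Clique G S → ∣ S ∣ ≤ ω
  colouring⇒clique-≤ {ω} h h<ω proper S clique =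
    subst (_≤ ω) (trans (List.length-map h (toList S)) (length-toList S))
      (unique-<⇒length-≤
        (AllPairs.map⁺ (unique-related⇒allPairs (λ u≢v u∈ v∈ → proper (clique _ _ u∈ v∈ u≢v))
          (toList-unique S) (All.tabulate (∈-toList⁻ S))))
        (All.map⁺ (All.tabulate λ {v} _ → h<ω v)))

module _ (ω d : ℕ) where

  -- Positions together with the two certificates for clique number ω. The field `bound` tells where
  -- a second layout can be placed without touching this one.
  record Layout : Set where
    field
      {order}      : ℕ
      pos          : Fin order → ℕ
      bound        : ℕ
      pos≤bound    : ∀ v → pos v ≤ bound
      colour       : Fin order → ℕ
      colour<ω     : ∀ v → colour v < ω
    graph : Graph order
    graph = posGraph d pos
    open Graph graph public
    field
      -- Serves only to bound the size of cliques by ω.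
      proper       : ∀ {u v} → Adj u v → colour u ≢ colour v
      clique       : List (Fin order)
      clique-adj   : AllPairs Adj clique
      clique-size  : length clique ≡ ω

    maxClique : MaxCliqueSize graph ω
    maxClique = (fromList clique , fromList-clique graph clique-adj
                , trans (∣fromList∣ (adj⇒unique graph clique-adj)) clique-size)
              , colouring⇒clique-≤ graph colour colour<ω proper

  module _ (P Q : Layout) where
    private
      module P = Layout P
      module Q = Layout Q
      n = P.order
      m = Q.order

      shift : ℕ
      -- Closed intervals that touch are adjacent, so `Q` starts one step beyond the last possible
      -- right end of `P`.
      shift = suc (P.bound + suc d)

      upos : Fin (n + m) → ℕ
      upos w = [ P.pos , (λ v → shift + Q.pos v) ]′ (splitAt n w)

      col : Fin n ⊎ Fin m → ℕ
      col = [ P.colour , Q.colour ]′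

      ucol : Fin (n + m) → ℕ
      ucol w = col (splitAt n w)

      union = posGraph d upos
      module U = Graph union

      splitAt-injective : ∀ {w x : Fin (n + m)} → splitAt n w ≡ splitAt n x → w ≡ x
      splitAt-injective {w} {x} eq = trans (sym (Fin.join-splitAt n m w))
        (trans (cong (join n m) eq) (Fin.join-splitAt n m x))

      same : ∀ {a} {A : Set a} {w x : Fin (n + m)} {u y : A} (f : A → Fin n ⊎ Fin m) →
             (∀ {i j} → f i ≡ f j → i ≡ j) → splitAt n w ≡ f u → splitAt n x ≡ f y →
             (w ≢ x → u ≢ y) × (u ≢ y → w ≢ x)
      same f inj p q = (λ w≢x u≡y → w≢x (splitAt-injective (trans p (trans (cong f u≡y) (sym q)))))
                     , (λ u≢y w≡x → u≢y (inj (trans (sym p) (trans (cong (splitAt n) w≡x) q))))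

      unshift : ∀ {a b} → shift + a ≤ (shift + b) + suc d → a ≤ b + suc d
      unshift {a} {b} h = ℕ.+-cancelˡ-≤ shift a (b + suc d) (subst (shift + a ≤_) (ℕ.+-assoc shift b (suc d)) h)

      reshift : ∀ {a b} → a ≤ b + suc d → shift + a ≤ (shift + b) + suc d
      reshift {a} {b} h = subst (shift + a ≤_) (sym (ℕ.+-assoc shift b (suc d))) (ℕ.+-monoʳ-≤ shift h)

      left : ∀ {w x : Fin (n + m)} {u y} → splitAt n w ≡ inj₁ u → splitAt n x ≡ inj₁ y → U.Adj w x ⇔ P.Adj u y
      left p q with same inj₁ (λ { refl → refl }) p q
      ... | ⇒ , ⇐ rewrite p | q = mk⇔ (λ (a , b) → ⇒ a , b) (λ (a , b) → ⇐ a , b)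

      right : ∀ {w x : Fin (n + m)} {u y} → splitAt n w ≡ inj₂ u → splitAt n x ≡ inj₂ y → U.Adj w x ⇔ Q.Adj u y
      right p q with same inj₂ (λ { refl → refl }) p q
      ... | ⇒ , ⇐ rewrite p | q = mk⇔ (λ (a , b , c) → ⇒ a , unshift b , unshift c)
                                      (λ (a , b , c) → ⇐ a , reshift b , reshift c)

      cross : ∀ {w x : Fin (n + m)} {u y} → splitAt n w ≡ inj₁ u → splitAt n x ≡ inj₂ y → ¬ U.Adj w x
      cross {u = u} {y} p q (_ , _ , far) rewrite p | q =
        ℕ.<⇒≱ (s≤s (ℕ.+-monoˡ-≤ (suc d) (P.pos≤bound u))) (ℕ.≤-trans (ℕ.m≤m+n shift (Q.pos y)) far)

      split : ∀ (w : Fin (n + m)) → (∃ λ u → splitAt n w ≡ inj₁ u) ⊎ (∃ λ u → splitAt n w ≡ inj₂ u)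
      split w with splitAt n w
      ... | inj₁ u = inj₁ (u , refl)
      ... | inj₂ u = inj₂ (u , refl)

      uproper : ∀ {w x} → U.Adj w x → ucol w ≢ ucol x
      uproper {w} {x} a with split w | split x
      ... | inj₁ (_ , p) | inj₂ (_ , q) = ⊥-elim (cross p q a)
      ... | inj₂ (_ , p) | inj₁ (_ , q) = ⊥-elim (cross q p (U.symm a))
      ... | inj₁ (_ , p) | inj₁ (_ , q) = subst₂ _≢_ (sym (cong col p)) (sym (cong col q)) (P.proper (to (left p q) a))
      ... | inj₂ (_ , p) | inj₂ (_ , q) = subst₂ _≢_ (sym (cong col p)) (sym (cong col q)) (Q.proper (to (right p q) a))

      upos≤ : ∀ w → upos w ≤ shift + Q.bound
      upos≤ w with splitAt n w
      ... | inj₁ u = ℕ.≤-trans (P.pos≤bound u) (ℕ.≤-trans (ℕ.m≤m+n P.bound (suc d))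
                       (ℕ.≤-trans (ℕ.n≤1+n _) (ℕ.m≤m+n shift Q.bound)))
      ... | inj₂ u = ℕ.+-monoʳ-≤ shift (Q.pos≤bound u)

      ucol< : ∀ w → ucol w < ω
      ucol< w with splitAt n w
      ... | inj₁ u = P.colour<ω u
      ... | inj₂ u = Q.colour<ω u

    _⊕_ : Layout
    _⊕_ = record
      { pos = upos ; bound = shift + Q.bound ; pos≤bound = upos≤
      ; colour = ucol ; colour<ω = ucol< ; proper = uproper
      ; clique = map (_↑ˡ m) P.clique
      ; clique-adj = AllPairs.map⁺ (AllPairs.map (λ {u} {v} → from (left (Fin.splitAt-↑ˡ n u m) (Fin.splitAt-↑ˡ n v m))) P.clique-adj)
      ; clique-size = trans (List.length-map _ P.clique) P.clique-size
      }

    ⊕-isDisjointUnion : IsDisjointUnion P.graph Q.graph union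
    ⊕-isDisjointUnion = record { left = left ; right = right ; cross = cross }

  -- With f = order P !, a further copy of P multiplies the fraction of bad
  -- orderings by at most (f ∸ 1) / f, and (f ∸ 1) (f + N + 1) ≤ f (f + N).
  bad-copies : ∀ (P : Layout) k → length (badOrderings (Layout.graph P) k) < Layout.order P ! → ∀ N →
               Σ Layout λ Q → length (badOrderings (Layout.graph Q) k) * (Layout.order P ! + N) ≤
                              Layout.order P ! * Layout.order Q !
  bad-copies P k bad<f zero = P , subst (λ x → length (badOrderings (Layout.graph P) k) * x ≤ Layout.order P ! * Layout.order P !)
    (sym (ℕ.+-identityʳ _)) (ℕ.*-monoˡ-≤ _ (ℕ.<⇒≤ bad<f))
  bad-copies P k bad<f (suc N) with bad-copies P k bad<f N
  ... | Q , ih = (P ⊕ Q) , ℕ.*-cancelʳ-≤ (X * (f + suc N)) (f * T′) (f * T)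
                   {{ℕ.m*n≢0 f T {{n!≢0 (Layout.order P)}} {{n!≢0 (Layout.order Q)}}}} (begin
    X * (f + suc N) * (f * T)   ≡⟨ r₁ X (f + suc N) (f * T) ⟩
    X * (f * T) * (f + suc N)   ≤⟨ ℕ.*-monoˡ-≤ (f + suc N) (bad-union (Layout.graph P) (Layout.graph Q) (Layout.graph (P ⊕ Q)) (⊕-isDisjointUnion P Q) k) ⟩
    a * (b * T′) * (f + suc N)  ≡⟨ r₂ a b T′ f N ⟩
    (a * (b * (f + N)) + a * b) * T′
      ≤⟨ ℕ.*-monoˡ-≤ T′ (ℕ.+-mono-≤ (ℕ.*-monoʳ-≤ a ih) (ℕ.*-monoʳ-≤ a (bad≤! (Layout.graph Q) k))) ⟩
    (a * (f * T) + a * T) * T′  ≤⟨ ℕ.*-monoˡ-≤ T′ (ℕ.+-monoʳ-≤ (a * (f * T)) (ℕ.*-monoˡ-≤ T (ℕ.<⇒≤ bad<f))) ⟩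
    (a * (f * T) + f * T) * T′  ≡⟨ r₃ a f T T′ ⟩
    suc a * (f * T) * T′        ≤⟨ ℕ.*-monoˡ-≤ T′ (ℕ.*-monoˡ-≤ (f * T) bad<f) ⟩
    f * (f * T) * T′            ≡⟨ r₁ f (f * T) T′ ⟩
    f * T′ * (f * T)            ∎)
    where
    open ℕ.≤-Reasoning
    n!≢0 = ℕ._!≢0
    f = Layout.order P !
    T = Layout.order Q !
    T′ = Layout.order (P ⊕ Q) !
    a = length (badOrderings (Layout.graph P) k)
    b = length (badOrderings (Layout.graph Q) k)
    X = length (badOrderings (Layout.graph (P ⊕ Q)) k)
    r₁ : ∀ x y z → x * y * z ≡ x * z * y
    r₁ = solve-∀
    r₂ : ∀ a b t f n → a * (b * t) * (f + (1 + n)) ≡ (a * (b * (f + n)) + a * b) * t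
    r₂ = solve-∀
    r₃ : ∀ a f t t′ → (a * (f * t) + f * t) * t′ ≡ (1 + a) * (f * t) * t′
    r₃ = solve-∀

-- Greedy colourings as outcomes of FirstFit

leastFree-≡ : ∀ {cs c} → 1 ≤ c → ¬ c List.∈ cs → (∀ k → 1 ≤ k → k < c → k List.∈ cs) → leastFree cs ≡ c
leastFree-≡ {cs} {c} 1≤c c∉ below with leastFree-spec cs
... | 1≤f , f∉ , below′ with ℕ.<-cmp (leastFree cs) c
...   | tri< f<c _ _ = ⊥-elim (f∉ (below _ 1≤f f<c))
...   | tri≈ _ eq _  = eq
...   | tri> _ _ c<f = ⊥-elim (c∉ (below′ c 1≤c c<f))

-- Also known as a Grundy colouring. FirstFit reproduces it when the vertices arrive by increasing
-- colour.
record IsGreedyColouring {n} (G : Graph n) (c : Fin n → ℕ) : Set where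
  open Graph G
  field
    positive : ∀ v → 1 ≤ c v
    proper   : ∀ {u v} → Adj u v → c u ≢ c v
    support  : ∀ v k → 1 ≤ k → k < c v → ∃ λ u → Adj v u × c u ≡ k

module _ {n} (G : Graph n) {c : Fin n → ℕ} (greedy : IsGreedyColouring G c) where
  open Graph G
  open IsGreedyColouring greedy

  -- The vertices still to come have colours at least that of the next vertex `v`. So `support`
  -- finds every colour below `c v` on a processed neighbour, while `proper` keeps `c v` itself
  -- free.
  firstFit-sorted : ∀ vs σ → (∀ u → u List.∈ vs ⊎ u List.∈ σ) → AllPairs (λ u v → c u ≤ c v) σ →
                    ∀ u → c u List.∈ map proj₂ (foldl (colourNext G) (map (λ v → v , c v) vs) σ)
  firstFit-sorted vs [] all [] u with all u
  ... | inj₁ u∈ = ∈-map⁺ proj₂ (∈-map⁺ (λ v → v , c v) u∈)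
  firstFit-sorted vs (v ∷ σ) all (v≤ ∷ sorted) =
    subst (λ k → ∀ u → c u List.∈ map proj₂ (foldl (colourNext G) ((v , k) ∷ map (λ v → v , c v) vs) σ))
      (sym (leastFree-≡ (positive v) fresh below))
      (firstFit-sorted (v ∷ vs) σ all′ sorted)
    where
    nbrs = filter (λ uc → adj? v (proj₁ uc)) (map (λ v → v , c v) vs)

    all′ : ∀ u → u List.∈ v ∷ vs ⊎ u List.∈ σ
    all′ u with all u
    ... | inj₁ u∈         = inj₁ (there u∈)
    ... | inj₂ (here eq)  = inj₁ (here eq)
    ... | inj₂ (there u∈) = inj₂ u∈

    fresh : ¬ c v List.∈ map proj₂ nbrs
    fresh p with ∈-map⁻ proj₂ p
    ... | (u , k) , q , eq with ∈-filter⁻ (λ uc → adj? v (proj₁ uc)) {xs = map (λ v → v , c v) vs} q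
    ...   | r , a with ∈-map⁻ (λ v → v , c v) r
    ...     | _ , _ , refl = proper a eq

    below : ∀ k → 1 ≤ k → k < c v → k List.∈ map proj₂ nbrs
    below k 1≤k k<c with support v k 1≤k k<c
    ... | u , a , refl with all u
    ...   | inj₁ u∈         = ∈-map⁺ proj₂ (∈-filter⁺ _ (∈-map⁺ (λ v → v , c v) u∈) a)
    ...   | inj₂ (here refl) = ⊥-elim (ℕ.<-irrefl refl k<c)
    ...   | inj₂ (there u∈) = ⊥-elim (ℕ.<⇒≱ k<c (All.lookup v≤ u∈))

  private
    byColour : DecTotalOrder _ _ _
    byColour = On.decTotalOrder ℕ.≤-decTotalOrder c

    module S = Sort byColour

  greedy-attained : ∀ v → ∃ λ σ → σ List.∈ orderings n × c v ≤ coloursUsed G σ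
  greedy-attained v = σ , from (∈-orderings n σ) (S.sort-↭ (allFin n)) , ≤-distinct used
    where
    σ = S.sort (allFin n)
    attained : ∀ u → c u List.∈ map proj₂ (firstFit G σ)
    attained = firstFit-sorted [] σ (λ u → inj₂ (∈-resp-↭ (↭-sym (S.sort-↭ (allFin n))) (∈-allFin u)))
                 (Sorted.Sorted⇒AllPairs (DecTotalOrder.totalOrder byColour) (S.sort-↗ (allFin n)))
    used : ∀ k → 1 ≤ k → k ≤ c v → k List.∈ map proj₂ (firstFit G σ)
    used k 1≤k k≤c with ℕ.m≤n⇒m<n∨m≡n k≤c
    ... | inj₂ refl = attained v
    ... | inj₁ k<c with support v k 1≤k k<c
    ...   | u , _ , refl = attained u

  -- A single ordering that is not bad is all that `bad-copies` asks for.
  greedy-bad<! : ∀ v → length (badOrderings G (c v)) < n !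
  greedy-bad<! v with greedy-attained v
  ... | σ , σ∈ , good = subst (length (badOrderings G (c v)) <_) (length-orderings n)
    (List.filter-notAll _ (orderings n) (lose σ∈ λ bad → ℕ.<⇒≱ bad good))


-- A unit interval graph on which FirstFit can reach 2ω - 1 colours

d+d≡d*2 : ∀ d → d + d ≡ d * 2
d+d≡d*2 = solve-∀

-- Different numbers with the same residue have different quotients, hence are at least d + 1 apart.
<⇒%-≢ : ∀ {x y d} → x < y → y ≤ x + d → x % suc d ≢ y % suc d
<⇒%-≢ {x} {y} {d} x<y y≤x+d eq = ℕ.<⇒≱ (s≤s y≤x+d) (begin
  suc (x + d)                   ≡⟨ ℕ.+-suc x d ⟨
  x + D                         ≡⟨ cong (_+ D) (m≡m%n+[m/n]*n x D) ⟩
  x % D + (x div D) * D + D       ≡⟨ ℕ.+-assoc (x % D) _ D ⟩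
  x % D + ((x div D) * D + D)     ≡⟨ cong (λ k → x % D + k) (ℕ.+-comm _ D) ⟩
  x % D + suc (x div D) * D       ≤⟨ ℕ.+-monoʳ-≤ (x % D) (ℕ.*-monoˡ-≤ D p<q) ⟩
  x % D + (y div D) * D           ≡⟨ cong (_+ (y div D) * D) eq ⟩
  y % D + (y div D) * D           ≡⟨ m≡m%n+[m/n]*n y D ⟨
  y ∎)
  where
  open ℕ.≤-Reasoning
  D : ℕ
  D = suc d
  p<q : x div D < y div D
  p<q = ℕ.*-cancelʳ-< D (x div D) (y div D) (ℕ.+-cancelˡ-< (x % D) _ _
    (subst₂ _<_ (m≡m%n+[m/n]*n x D) (trans (m≡m%n+[m/n]*n y D) (cong (_+ (y div D) * D) (sym eq))) x<y))

%2-cases : ∀ q {b} → b < 2 → q % 2 ≡ b ⊎ suc q % 2 ≡ b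
%2-cases zero          {0} _ = inj₁ refl
%2-cases zero          {1} _ = inj₂ refl
%2-cases 1             {0} _ = inj₂ refl
%2-cases 1             {1} _ = inj₁ refl
%2-cases (suc (suc q)) b<2   = %2-cases q b<2
%2-cases zero          {suc (suc _)} (s≤s (s≤s ()))
%2-cases 1             {suc (suc _)} (s≤s (s≤s ()))

-- The left side of the hypothesis is odd, the right side even. For the rows of tiles below this
-- means that an odd block is never the last one on the right.
odd-<-even : ∀ {q i} m → q + i * 2 ≤ m * 2 → q % 2 ≡ 1 → suc q + i * 2 ≤ m * 2
odd-<-even {q} {i} m le odd with ℕ.m≤n⇒m<n∨m≡n le
... | inj₁ lt = lt
... | inj₂ eq with trans (sym odd) (trans (sym ([m+kn]%n≡m%n q i 2)) (trans (cong (_% 2) eq) (m*n%n≡0 m 2)))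
...   | ()

%2+*2-injective : ∀ p q {i j} → p % 2 + i * 2 ≡ q % 2 + j * 2 → p % 2 ≡ q % 2 × i ≡ j
%2+*2-injective p q {i} {j} eq = par , ℕ.*-cancelʳ-≡ i j 2 (ℕ.+-cancelˡ-≡ (p % 2) _ _ (trans eq (cong (_+ j * 2) (sym par))))
  where
  parity : ∀ p i → (p % 2 + i * 2) % 2 ≡ p % 2
  parity p i = trans ([m+kn]%n≡m%n (p % 2) i 2) (m%n%n≡m%n p 2)
  par : p % 2 ≡ q % 2
  par = trans (sym (parity p i)) (trans (cong (_% 2) eq) (parity q j))

-- The order of q D + r and q′ D + r′ up to D is decided lexicographically.
block-≤⁻ : ∀ {d q r q′ r′} → r′ < suc d → q * suc d + r ≤ (q′ * suc d + r′) + suc d →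
           q ≤ q′ ⊎ (q ≡ suc q′ × r ≤ r′)
block-≤⁻ {d} {q} {r} {q′} {r′} r′< le with ℕ.<-cmp q (suc q′)
... | tri< (s≤s q≤q′) _ _ = inj₁ q≤q′
... | tri≈ _ refl _ = inj₂ (refl , ℕ.+-cancelˡ-≤ (suc q′ * suc d) r r′ (subst (suc q′ * suc d + r ≤_) (re q′ r′ (suc d)) le))
  where
  re : ∀ q r D → q * D + r + D ≡ (1 + q) * D + r
  re = solve-∀
... | tri> _ _ q>1+q′ = ⊥-elim (ℕ.<⇒≱ lt le)
  where
  open ℕ.≤-Reasoning
  re : ∀ q D → q * D + D + D ≡ (2 + q) * D
  re = solve-∀
  lt : q′ * suc d + r′ + suc d < q * suc d + r
  lt = begin-strict
    q′ * suc d + r′ + suc d     <⟨ ℕ.+-monoˡ-< (suc d) (ℕ.+-monoʳ-< (q′ * suc d) r′<) ⟩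
    q′ * suc d + suc d + suc d  ≡⟨ re q′ (suc d) ⟩
    suc (suc q′) * suc d        ≤⟨ ℕ.*-monoˡ-≤ (suc d) q>1+q′ ⟩
    q * suc d                   ≤⟨ ℕ.m≤m+n _ r ⟩
    q * suc d + r               ∎

block-≤⁺ : ∀ {d q r q′ r′} → r < suc d → q ≤ q′ ⊎ (q ≡ suc q′ × r ≤ r′) →
           q * suc d + r ≤ (q′ * suc d + r′) + suc d
block-≤⁺ {d} {q} {r} {q′} {r′} r< (inj₁ q≤q′) = ℕ.+-mono-≤ (ℕ.≤-trans (ℕ.*-monoˡ-≤ (suc d) q≤q′) (ℕ.m≤m+n _ r′)) (ℕ.<⇒≤ r<)
block-≤⁺ {d} {q} {r} {q′} {r′} r< (inj₂ (refl , r≤r′)) = subst (suc q′ * suc d + r ≤_) (re q′ r′ (suc d)) (ℕ.+-monoʳ-≤ (suc q′ * suc d) r≤r′)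
  where
  re : ∀ q r D → (1 + q) * D + r ≡ q * D + r + D
  re = solve-∀

-- With 1 / (2d + 1) as the unit of length, a tile with block q and offset r is
-- the interval of length 2d + 1 starting at q (2d + 1) + r. To either side of the
-- centre, each layer i < d is a row of tiles that touch end to end, with colours
-- alternating between 2i + 1 and 2i + 2. The tiles of layer i next to the centre
-- have colour 2i + 1 on the left and 2i + 2 on the right, so the centre gets
-- colour 2d + 1.
module _ (d : ℕ) where

  data Tile : Set where
    centre     : Tile
    left right : (i q : ℕ) → Tile

  block : Tile → ℕ
  block centre      = d * 2
  block (left i q)  = q
  block (right i q) = q

  -- Offsets fall with the layer on the left and rise on the right. Towards a lower layer, a left
  -- tile thereby reaches the preceding block and a right tile the following one. All left offsets
  -- are below all right ones, which keeps the sides apart; the centre has the largest offset and so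
  -- meets the whole first block on its right.
  offset : Tile → ℕ
  offset centre      = d * 2
  offset (left i q)  = d ∸ suc i
  offset (right i q) = d + i

  -- A tile is supported in each lower layer by the tiles of the same block and of
  -- the adjacent block farther from the centre, so the rows must get shorter as i
  -- grows. Every row on the right ends in its odd colour because 4d is even.
  Valid : Tile → Set
  Valid centre      = ⊤
  Valid (left i q)  = i < d × i ≤ q × q ≤ d * 2
  Valid (right i q) = i < d × d * 2 < q × q + i * 2 ≤ d * 2 * 2

  valid? : ∀ t → Dec (Valid t)
  valid? centre      = yes tt
  valid? (left i q)  = i ℕ.<? d ×-dec i ℕ.≤? q ×-dec q ℕ.≤? d * 2
  valid? (right i q) = i ℕ.<? d ×-dec d * 2 ℕ.<? q ×-dec q + i * 2 ℕ.≤? d * 2 * 2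

  tileColour : Tile → ℕ
  tileColour centre      = suc (d * 2)
  tileColour (left i q)  = suc (q % 2 + i * 2)
  tileColour (right i q) = suc (q % 2 + i * 2)

  data Near (s t : Tile) : Set where
    same  : block s ≡ block t → Near s t
    after : block t ≡ suc (block s) → offset t ≤ offset s → Near s t
    before : block s ≡ suc (block t) → offset s ≤ offset t → Near s t

  near-sym : ∀ {s t} → Near s t → Near t s
  near-sym (same p)     = same (sym p)
  near-sym (after p q)  = before p q
  near-sym (before p q) = after p q

  ∸< : ∀ {i} → i < d → d ∸ suc i < d
  ∸< i<d = ℕ.∸-monoʳ-< (s≤s z≤n) i<d

  offset< : ∀ t → Valid t → offset t < suc (d * 2)
  offset< centre      _ = ℕ.≤-refl
  offset< (left i q)  (i<d , _) = s≤s (ℕ.≤-trans (ℕ.m∸n≤m d (suc i)) (ℕ.m≤m*n d 2))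
  offset< (right i q) (i<d , _) = s≤s (ℕ.≤-trans (ℕ.+-monoʳ-≤ d (ℕ.<⇒≤ i<d)) (ℕ.≤-reflexive (d+d≡d*2 d)))

  parity≤ : ∀ {i q} → i < d → q % 2 + i * 2 < d * 2
  parity≤ {i} {q} i<d = ℕ.≤-trans (ℕ.+-monoˡ-< (i * 2) (m%n<n q 2)) (ℕ.*-monoˡ-≤ 2 i<d)

  consecutive-%2 : ∀ {p q : ℕ} → q ≡ suc p → p % 2 ≢ q % 2
  consecutive-%2 {p} refl = <⇒%-≢ {p} {suc p} {1} ℕ.≤-refl (ℕ.≤-reflexive (ℕ.+-comm 1 p))

  left-right-far : ∀ {i p j q} → Valid (left i p) → Valid (right j q) → ¬ Near (left i p) (right j q)
  left-right-far (_ , _ , p≤) (_ , <q , _) (same refl)     = ℕ.<⇒≱ <q p≤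
  left-right-far (i<d , _) _ (after _ le)                  = ℕ.<⇒≱ (ℕ.<-≤-trans (∸< i<d) (ℕ.m≤m+n d _)) le
  left-right-far (_ , _ , p≤) (_ , <q , _) (before refl _) = ℕ.<⇒≱ <q (ℕ.≤-trans (ℕ.n≤1+n _) p≤)

  near-row : ∀ {p q : ℕ} → q ≡ p ⊎ q ≡ suc p ⊎ p ≡ suc q → p % 2 ≡ q % 2 → p ≡ q
  near-row (inj₁ eq)        par = sym eq
  near-row (inj₂ (inj₁ eq)) par = ⊥-elim (consecutive-%2 eq par)
  near-row (inj₂ (inj₂ eq)) par = ⊥-elim (consecutive-%2 eq (sym par))

  near-blocks : ∀ {s t} → Near s t → block t ≡ block s ⊎ block t ≡ suc (block s) ⊎ block s ≡ suc (block t)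
  near-blocks (same p)     = inj₁ (sym p)
  near-blocks (after p _)  = inj₂ (inj₁ p)
  near-blocks (before p _) = inj₂ (inj₂ p)

  -- A colour below that of the centre determines the layer and the parity of the block. The two
  -- sides do not meet, and near tiles of one row lie at most one block apart, so equal parity makes
  -- them equal.
  tileColour-proper : ∀ {s t} → Valid s → Valid t → Near s t → tileColour s ≡ tileColour t → s ≡ t
  tileColour-proper {centre}    {centre}    vs vt near eq = refl
  tileColour-proper {centre}    {left j q}  vs vt near eq = ⊥-elim (ℕ.<⇒≢ (parity≤ {j} {q} (proj₁ vt)) (sym (ℕ.suc-injective eq)))
  tileColour-proper {centre}    {right j q} vs vt near eq = ⊥-elim (ℕ.<⇒≢ (parity≤ {j} {q} (proj₁ vt)) (sym (ℕ.suc-injective eq)))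
  tileColour-proper {left i p}  {centre}    vs vt near eq = ⊥-elim (ℕ.<⇒≢ (parity≤ {i} {p} (proj₁ vs)) (ℕ.suc-injective eq))
  tileColour-proper {right i p} {centre}    vs vt near eq = ⊥-elim (ℕ.<⇒≢ (parity≤ {i} {p} (proj₁ vs)) (ℕ.suc-injective eq))
  tileColour-proper {left i p}  {left j q}  vs vt near eq with %2+*2-injective p q {i} {j} (ℕ.suc-injective eq)
  ... | par , refl = cong (left i) (near-row (near-blocks near) par)
  tileColour-proper {right i p} {right j q} vs vt near eq with %2+*2-injective p q {i} {j} (ℕ.suc-injective eq)
  ... | par , refl = cong (right i) (near-row (near-blocks near) par)
  tileColour-proper {left i p}  {right j q} vs vt near eq = ⊥-elim (left-right-far vs vt near)
  tileColour-proper {right i p} {left j q}  vs vt near eq = ⊥-elim (left-right-far vt vs (near-sym near))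

  coloured : ∀ q k → q % 2 ≡ k % 2 → suc (q % 2 + (k div 2) * 2) ≡ suc k
  coloured q k eq = cong suc (trans (cong (_+ (k div 2) * 2) eq) (sym (m≡m%n+[m/n]*n k 2)))

  -- Layer i has only the colours 2i + 1 and 2i + 2, the latter on odd blocks. A smaller colour than
  -- the tile's own lies in a lower layer, or it is 2i + 1 and the tile has 2i + 2.
  layer-cases : ∀ {i q} k → k < q % 2 + i * 2 → k div 2 < i ⊎ (k div 2 ≡ i × q % 2 ≡ 1 × suc q % 2 ≡ k % 2)
  layer-cases {i} {q} k k< with ℕ.m≤n⇒m<n∨m≡n (ℕ.≤-pred (m<n*o⇒m/o<n {k} {suc i} {2} (ℕ.<-≤-trans k< (ℕ.+-monoˡ-≤ (i * 2) (ℕ.<⇒≤ (m%n<n q 2))))))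
  ... | inj₁ j<i = inj₁ j<i
  ... | inj₂ refl = inj₂ (refl , odd , even)
    where
    lt : k % 2 < q % 2
    lt = ℕ.+-cancelʳ-< ((k div 2) * 2) (k % 2) (q % 2) (subst (_< q % 2 + (k div 2) * 2) (m≡m%n+[m/n]*n k 2) k<)
    odd : q % 2 ≡ 1
    odd = ℕ.≤-antisym (ℕ.≤-pred (m%n<n q 2)) (ℕ.≤-trans (s≤s z≤n) lt)
    even : suc q % 2 ≡ k % 2
    even with %2-cases q (m%n<n k 2)
    ... | inj₁ eq = ⊥-elim (ℕ.<⇒≢ lt (sym eq))
    ... | inj₂ eq = eq

  -- Colour `suc k` lives in layer `k div 2` on the blocks with the parity of `k`. In a lower layer
  -- the tile meets two consecutive blocks, and one of them has this parity. The centre meets block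
  -- 2d on the left and block 2d + 1 on the right.
  tileColour-support : ∀ t → Valid t → ∀ k → suc k < tileColour t →
                       ∃ λ s → Valid s × Near t s × tileColour s ≡ suc k
  tileColour-support centre _ k (s≤s k<) with m<n*o⇒m/o<n {k} {d} {2} k< | %2-cases (d * 2) (m%n<n k 2)
  ... | j<d | inj₁ eq = left (k div 2) (d * 2) , (j<d , ℕ.≤-trans (ℕ.<⇒≤ j<d) (ℕ.m≤m*n d 2) , ℕ.≤-refl)
                      , same refl , coloured (d * 2) k eq
  ... | j<d | inj₂ eq = right (k div 2) (suc (d * 2)) , (j<d , ℕ.≤-refl , fits)
                      , after refl (ℕ.≤-trans (ℕ.+-monoʳ-≤ d (ℕ.<⇒≤ j<d)) (ℕ.≤-reflexive (d+d≡d*2 d)))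
                      , coloured (suc (d * 2)) k eq
    where
    fits : suc (d * 2) + (k div 2) * 2 ≤ d * 2 * 2
    fits = ℕ.≤-trans (ℕ.≤-trans (ℕ.≤-reflexive (sym (ℕ.+-suc (d * 2) _)))
             (ℕ.+-monoʳ-≤ (d * 2) (ℕ.≤-trans (ℕ.n≤1+n _) (ℕ.*-monoˡ-≤ 2 j<d)))) (ℕ.≤-reflexive (d+d≡d*2 (d * 2)))
  tileColour-support (left i q) (i<d , i≤q , q≤) k (s≤s k<) with layer-cases {i} {q} k k<
  ... | inj₂ (refl , odd , eq) = left i (suc q)
      , (i<d , ℕ.≤-trans i≤q (ℕ.n≤1+n q) , subst (_≤ d * 2) (ℕ.+-identityʳ (suc q))
          (odd-<-even {q} {0} d (subst (_≤ d * 2) (sym (ℕ.+-identityʳ q)) q≤) odd))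
      , after refl ℕ.≤-refl , coloured (suc q) k eq
  tileColour-support (left i zero) (_ , i≤0 , _) k _ | inj₁ j<i = ⊥-elim (ℕ.<⇒≱ j<i (ℕ.≤-trans i≤0 z≤n))
  tileColour-support (left i (suc p)) (i<d , i≤q , q≤) k (s≤s k<) | inj₁ j<i with %2-cases p (m%n<n k 2)
  ... | inj₁ eq = left (k div 2) p , (ℕ.<-trans j<i i<d , ℕ.≤-pred (ℕ.≤-trans j<i i≤q) , ℕ.≤-trans (ℕ.n≤1+n p) q≤)
                , before refl (ℕ.∸-monoʳ-≤ d (s≤s (ℕ.<⇒≤ j<i))) , coloured p k eq
  ... | inj₂ eq = left (k div 2) (suc p) , (ℕ.<-trans j<i i<d , ℕ.≤-trans (ℕ.<⇒≤ j<i) i≤q , q≤)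
                , same refl , coloured (suc p) k eq
  tileColour-support (right i q) (i<d , <q , q≤) k (s≤s k<) with layer-cases {i} {q} k k<
  ... | inj₂ (refl , odd , eq) = right i (suc q)
      , (i<d , ℕ.≤-trans <q (ℕ.n≤1+n q) , odd-<-even {q} {i} (d * 2) q≤ odd)
      , after refl ℕ.≤-refl , coloured (suc q) k eq
  ... | inj₁ j<i with %2-cases q (m%n<n k 2)
  ...   | inj₁ eq = right (k div 2) q
                  , (ℕ.<-trans j<i i<d , <q , ℕ.≤-trans (ℕ.+-monoʳ-≤ q (ℕ.*-monoˡ-≤ 2 (ℕ.<⇒≤ j<i))) q≤)
                  , same refl , coloured q k eq
  ...   | inj₂ eq = right (k div 2) (suc q)
                  , (ℕ.<-trans j<i i<d , ℕ.≤-trans <q (ℕ.n≤1+n q)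
                    , ℕ.≤-trans (ℕ.≤-reflexive (sym (ℕ.+-suc q _)))
                        (ℕ.≤-trans (ℕ.+-monoʳ-≤ q (ℕ.≤-trans (ℕ.n≤1+n _) (ℕ.*-monoˡ-≤ 2 j<i))) q≤))
                  , after refl (ℕ.+-monoʳ-≤ d (ℕ.<⇒≤ j<i)) , coloured (suc q) k eq

  -- The position of a tile in the order from left to right, up to a constant.
  -- Overlapping tiles differ by at most d in this index.
  tileIndex : Tile → ℕ
  tileIndex centre      = d * 2 * d + d
  tileIndex (left i q)  = q * d + (d ∸ suc i)
  tileIndex (right i q) = q * d + suc i

  -- `Near` with a direction: for valid tiles, `t` starts strictly to the right of `s`.
  Next : Tile → Tile → Set
  Next s t = (block t ≡ block s × offset s < offset t) ⊎ (block t ≡ suc (block s) × offset t ≤ offset s)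

  within-block : ∀ p {x y} → x < y → y ≤ d → p * d + x < p * d + y × p * d + y ≤ p * d + x + d
  within-block p {x} {y} x<y y≤d = ℕ.+-monoʳ-< (p * d) x<y , (begin
    p * d + y      ≤⟨ ℕ.+-mono-≤ (ℕ.m≤m+n (p * d) x) y≤d ⟩
    p * d + x + d  ∎)
    where open ℕ.≤-Reasoning

  across-blocks : ∀ p {x y} → y ≤ x → x < d + y → p * d + x < suc p * d + y × suc p * d + y ≤ p * d + x + d
  across-blocks p {x} {y} y≤x x<d+y =
    ℕ.<-≤-trans (ℕ.+-monoʳ-< (p * d) x<d+y) (ℕ.≤-reflexive (re p d y)) ,
    ℕ.≤-trans (ℕ.+-monoʳ-≤ (d + p * d) y≤x) (ℕ.≤-reflexive (re₂ p d x))
    where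
    re : ∀ p d y → p * d + (d + y) ≡ d + p * d + y
    re = solve-∀
    re₂ : ∀ p d x → d + p * d + x ≡ p * d + x + d
    re₂ = solve-∀

  tileIndex-next : ∀ s t → Valid s → Valid t → Next s t → tileIndex s < tileIndex t × tileIndex t ≤ tileIndex s + d
  tileIndex-next centre      centre      _ _ (inj₁ (_ , lt)) = ⊥-elim (ℕ.<-irrefl refl lt)
  tileIndex-next centre      centre      _ _ (inj₂ (eq , _)) = ⊥-elim (ℕ.1+n≢n (sym eq))
  tileIndex-next centre      (left j q)  _ _ (inj₁ (_ , lt)) =
    ⊥-elim (ℕ.<⇒≱ lt (ℕ.≤-trans (ℕ.m∸n≤m d (suc j)) (ℕ.m≤m*n d 2)))
  tileIndex-next centre      (left j q)  _ (_ , _ , q≤) (inj₂ (refl , _)) = ⊥-elim (ℕ.<⇒≱ (s≤s ℕ.≤-refl) q≤)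
  tileIndex-next centre      (right j q) _ (_ , <q , _) (inj₁ (refl , _)) = ⊥-elim (ℕ.<-irrefl refl <q)
  tileIndex-next centre      (right j q) _ (j<d , _) (inj₂ (refl , _)) =
    across-blocks (d * 2) j<d (ℕ.m<m+n d (s≤s z≤n))
  tileIndex-next (left i p)  centre      (i<d , _) _ (inj₁ (refl , _)) = within-block p (∸< i<d) ℕ.≤-refl
  tileIndex-next (left i p)  centre      (i<d , _) _ (inj₂ (_ , le)) =
    ⊥-elim (ℕ.<⇒≱ (ℕ.<-≤-trans (∸< i<d) (ℕ.m≤m*n d 2)) le)
  tileIndex-next (left i p)  (left j q)  _ (j<d , _) (inj₁ (refl , lt)) = within-block p lt (ℕ.m∸n≤m d (suc j))
  tileIndex-next (left i p)  (left j q)  (i<d , _) _ (inj₂ (refl , le)) =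
    across-blocks p le (ℕ.<-≤-trans (∸< i<d) (ℕ.m≤m+n d _))
  tileIndex-next (left i p)  (right j q) vs vt (inj₁ (eq , _)) = ⊥-elim (left-right-far vs vt (same (sym eq)))
  tileIndex-next (left i p)  (right j q) vs vt (inj₂ (eq , le)) = ⊥-elim (left-right-far vs vt (after eq le))
  tileIndex-next (right i p) centre      (_ , <p , _) _ (inj₁ (refl , _)) = ⊥-elim (ℕ.<-irrefl refl <p)
  tileIndex-next (right i p) centre      (_ , <p , _) _ (inj₂ (eq , _)) =
    ⊥-elim (ℕ.<⇒≱ <p (ℕ.≤-trans (ℕ.n≤1+n p) (ℕ.≤-reflexive (sym eq))))
  tileIndex-next (right i p) (left j q)  vs vt (inj₁ (eq , _)) = ⊥-elim (left-right-far vt vs (same eq))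
  tileIndex-next (right i p) (left j q)  vs vt (inj₂ (eq , le)) = ⊥-elim (left-right-far vt vs (before eq le))
  tileIndex-next (right i p) (right j q) _ (j<d , _) (inj₁ (refl , lt)) =
    within-block p (s≤s (ℕ.+-cancelˡ-< d i j lt)) j<d
  tileIndex-next (right i p) (right j q) (i<d , _) _ (inj₂ (refl , le)) =
    across-blocks p (s≤s (ℕ.+-cancelˡ-≤ d j i le)) (ℕ.≤-<-trans i<d (ℕ.m<m+n d (s≤s z≤n)))

  tile-≡ : ∀ s t → Valid s → Valid t → block s ≡ block t → offset s ≡ offset t → s ≡ t
  tile-≡ centre      centre      _ _ _ _ = refl
  tile-≡ centre      (left j q)  _ (j<d , _) _ eq =
    ⊥-elim (ℕ.<⇒≢ (ℕ.<-≤-trans (∸< j<d) (ℕ.m≤m*n d 2)) (sym eq))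
  tile-≡ centre      (right j q) _ (_ , <q , _) refl _ = ⊥-elim (ℕ.<-irrefl refl <q)
  tile-≡ (left i p)  centre      (i<d , _) _ _ eq = ⊥-elim (ℕ.<⇒≢ (ℕ.<-≤-trans (∸< i<d) (ℕ.m≤m*n d 2)) eq)
  tile-≡ (left i p)  (left j q)  (i<d , _) (j<d , _) refl eq =
    cong (λ i → left i p) (ℕ.suc-injective (ℕ.∸-cancelˡ-≡ i<d j<d eq))
  tile-≡ (left i p)  (right j q) vs vt eq _ = ⊥-elim (left-right-far vs vt (same eq))
  tile-≡ (right i p) centre      (_ , <p , _) _ refl _ = ⊥-elim (ℕ.<-irrefl refl <p)
  tile-≡ (right i p) (left j q)  vs vt eq _ = ⊥-elim (left-right-far vt vs (same (sym eq)))
  tile-≡ (right i p) (right j q) _ _ refl eq = cong (λ i → right i p) (ℕ.+-cancelˡ-≡ d i j eq)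

  -- These residues form the colouring with d + 1 colours that bounds the cliques. It is a different
  -- colouring from `tileColour`, which is the greedy one with 2d + 1 colours.
  tileIndex-proper : ∀ {s t} → Valid s → Valid t → s ≢ t → Near s t → tileIndex s % suc d ≢ tileIndex t % suc d
  tileIndex-proper {s} {t} vs vt s≢t near = go near
    where
    forth : Next s t → tileIndex s % suc d ≢ tileIndex t % suc d
    forth n = let lt , le = tileIndex-next s t vs vt n in <⇒%-≢ lt le
    back : Next t s → tileIndex s % suc d ≢ tileIndex t % suc d
    back n eq = let lt , le = tileIndex-next t s vt vs n in <⇒%-≢ lt le (sym eq)
    go : Near s t → tileIndex s % suc d ≢ tileIndex t % suc d
    go (after eq le)  = forth (inj₂ (eq , le))
    go (before eq le) = back (inj₂ (eq , le))
    go (same eq) with ℕ.<-cmp (offset s) (offset t)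
    ... | tri< lt _ _  = forth (inj₁ (sym eq , lt))
    ... | tri≈ _ eq′ _ = ⊥-elim (s≢t (tile-≡ s t vs vt eq eq′))
    ... | tri> _ _ gt  = back (inj₁ (eq , gt))

  -- The tiles realised as vertices of a unit interval graph

  tilePos : Tile → ℕ
  tilePos t = block t * suc (d * 2) + offset t

  close⇒near : ∀ {s t} → Valid s → Valid t → tilePos s ≤ tilePos t + suc (d * 2) →
               tilePos t ≤ tilePos s + suc (d * 2) → Near s t
  close⇒near {s} {t} vs vt le ge
    with block-≤⁻ {q = block s} {q′ = block t} (offset< t vt) le
       | block-≤⁻ {q = block t} {q′ = block s} (offset< s vs) ge
  ... | inj₂ (eq , le′) | _               = before eq le′
  ... | inj₁ _          | inj₂ (eq , le′) = after eq le′
  ... | inj₁ p          | inj₁ q          = same (ℕ.≤-antisym p q)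

  near⇒close : ∀ {s t} → Valid s → Near s t → tilePos s ≤ tilePos t + suc (d * 2)
  near⇒close {s} {t} vs near = block-≤⁺ {q = block s} {q′ = block t} (offset< s vs) (blocks near)
    where
    blocks : Near s t → block s ≤ block t ⊎ (block s ≡ suc (block t) × offset s ≤ offset t)
    blocks (same eq)      = inj₁ (ℕ.≤-reflexive eq)
    blocks (after eq _)   = inj₁ (ℕ.≤-trans (ℕ.n≤1+n _) (ℕ.≤-reflexive (sym eq)))
    blocks (before eq le) = inj₂ (eq , le)

  blocks : List ℕ
  blocks = upTo (suc (d * 2 * 2))

  row : (ℕ → ℕ → Tile) → List Tile
  row side = cartesianProductWith side (upTo d) blocks

  allTiles tiles : List Tile
  allTiles = centre ∷ (row left ++ row right)
  tiles    = filter valid? allTiles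

  tiles-unique : Unique tiles
  tiles-unique = Unique.filter⁺ valid? (All.tabulate centre∉ ∷ Unique.++⁺
    (Unique.cartesianProductWith⁺ left (λ { refl → refl , refl }) (Unique.upTo⁺ d) (Unique.upTo⁺ _))
    (Unique.cartesianProductWith⁺ right (λ { refl → refl , refl }) (Unique.upTo⁺ d) (Unique.upTo⁺ _))
    λ (p , q) → left∩right p q)
    where
    left∩right : ∀ {t} → t List.∈ row left → ¬ t List.∈ row right
    left∩right p q with ∈-cartesianProductWith⁻ left (upTo d) blocks p | ∈-cartesianProductWith⁻ right (upTo d) blocks q
    ... | _ , _ , _ , _ , refl | _ , _ , _ , _ , ()
    centre∉ : ∀ {t} → t List.∈ row left ++ row right → centre ≢ t
    centre∉ p refl with ∈-++⁻ (row left) p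
    ... | inj₁ q with ∈-cartesianProductWith⁻ left (upTo d) blocks q
    ...   | _ , _ , _ , _ , ()
    centre∉ p refl | inj₂ q with ∈-cartesianProductWith⁻ right (upTo d) blocks q
    ...   | _ , _ , _ , _ , ()

  valid⇒∈ : ∀ t → Valid t → t List.∈ tiles
  valid⇒∈ t v = ∈-filter⁺ valid? (∈-all t v) v
    where
    ∈-all : ∀ t → Valid t → t List.∈ allTiles
    ∈-all centre      _ = here refl
    ∈-all (left i q)  (i<d , _ , q≤) = there (∈-++⁺ˡ
      (∈-cartesianProductWith⁺ left (∈-upTo⁺ i<d) (∈-upTo⁺ (s≤s (ℕ.≤-trans q≤ (ℕ.m≤m*n (d * 2) 2))))))
    ∈-all (right i q) (i<d , _ , q≤) = there (∈-++⁺ʳ (row left)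
      (∈-cartesianProductWith⁺ right (∈-upTo⁺ i<d) (∈-upTo⁺ (s≤s (ℕ.≤-trans (ℕ.m≤m+n q _) q≤)))))

  tile : Fin (length tiles) → Tile
  tile = lookup tiles

  tile-valid : ∀ v → Valid (tile v)
  tile-valid v = proj₂ (∈-filter⁻ valid? {xs = allTiles} (∈-lookup v))

  vertex : ∀ t → Valid t → ∃ λ v → tile v ≡ t
  vertex t valid = index (valid⇒∈ t valid) , sym (lookup-index (valid⇒∈ t valid))

  private
    pos : Fin (length tiles) → ℕ
    pos v = tilePos (tile v)

    open Graph (posGraph (d * 2) pos)

    adj⁻ : ∀ {u v} → Adj u v → Near (tile u) (tile v)
    adj⁻ {u} {v} (_ , le , ge) = close⇒near (tile-valid u) (tile-valid v) le ge

    adj⁺ : ∀ {u v} → u ≢ v → Near (tile u) (tile v) → Adj u v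
    adj⁺ {u} {v} u≢v near = u≢v , near⇒close (tile-valid u) near , near⇒close (tile-valid v) (near-sym near)

    tile≢ : ∀ {u v} → u ≢ v → tile u ≢ tile v
    tile≢ u≢v eq = u≢v (unique-lookup-injective tiles-unique _ _ eq)

    left-valid : ∀ i → Valid (left (toℕ {d} i) (d * 2))
    left-valid i = Fin.toℕ<n i , ℕ.≤-trans (ℕ.<⇒≤ (Fin.toℕ<n i)) (ℕ.m≤m*n d 2) , ℕ.≤-refl

    centreVertex = proj₁ (vertex centre tt)
    tile-centre  = proj₂ (vertex centre tt)

    leftVertex : Fin d → Fin (length tiles)
    leftVertex i = proj₁ (vertex (left (toℕ i) (d * 2)) (left-valid i))

    tile-left : ∀ i → tile (leftVertex i) ≡ left (toℕ i) (d * 2)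
    tile-left i = proj₂ (vertex (left (toℕ i) (d * 2)) (left-valid i))

    clique : List (Fin (length tiles))
    clique = centreVertex ∷ tabulate leftVertex

    clique-adj : AllPairs Adj clique
    clique-adj = All.tabulate⁺ (λ i → adj⁺ (λ eq → centre≢left (trans (sym tile-centre) (trans (cong tile eq) (tile-left i))))
                                  (subst₂ Near (sym tile-centre) (sym (tile-left i)) (same refl)))
               ∷ AllPairs.tabulate⁺ λ {i} {j} i≢j → adj⁺
                   (λ eq → i≢j (Fin.toℕ-injective (left-injective (trans (sym (tile-left i)) (trans (cong tile eq) (tile-left j))))))
                   (subst₂ Near (sym (tile-left i)) (sym (tile-left j)) (same refl))
      where
      centre≢left : ∀ {i q} → centre ≢ left i q
      centre≢left ()
      left-injective : ∀ {i j p q} → left i p ≡ left j q → i ≡ j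
      left-injective refl = refl

  tileGreedy : IsGreedyColouring (posGraph (d * 2) pos) (λ v → tileColour (tile v))
  tileGreedy = record
    { positive = λ v → positive (tile v)
    ; proper   = λ {u} {v} a eq → tile≢ (proj₁ a) (tileColour-proper (tile-valid u) (tile-valid v) (adj⁻ a) eq)
    ; support  = support
    }
    where
    positive : ∀ t → 1 ≤ tileColour t
    positive centre      = s≤s z≤n
    positive (left i q)  = s≤s z≤n
    positive (right i q) = s≤s z≤n
    support : ∀ v k → 1 ≤ k → k < tileColour (tile v) → ∃ λ u → Adj v u × tileColour (tile u) ≡ k
    support v (suc k) _ k< with tileColour-support (tile v) (tile-valid v) k k<
    ... | s , vs , near , eq with vertex s vs
    ...   | u , refl = u , adj⁺ (λ { refl → ℕ.<-irrefl (sym eq) k< }) near , eq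

  tileLayout : Layout (suc d) (d * 2)
  tileLayout = record
    { pos = pos
    ; bound = suc (d * 2 * 2) * suc (d * 2)
    ; pos≤bound = λ v → pos≤ (tile-valid v)
    ; colour = λ v → tileIndex (tile v) % suc d
    ; colour<ω = λ v → m%n<n (tileIndex (tile v)) (suc d)
    ; proper = λ {u} {v} a → tileIndex-proper (tile-valid u) (tile-valid v) (tile≢ (proj₁ a)) (adj⁻ a)
    ; clique = clique
    ; clique-adj = clique-adj
    ; clique-size = cong suc (List.length-tabulate leftVertex)
    }
    where
    block≤ : ∀ t → Valid t → block t ≤ d * 2 * 2
    block≤ centre      _ = ℕ.m≤m*n (d * 2) 2
    block≤ (left i q)  (_ , _ , q≤) = ℕ.≤-trans q≤ (ℕ.m≤m*n (d * 2) 2)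
    block≤ (right i q) (_ , _ , q≤) = ℕ.≤-trans (ℕ.m≤m+n q _) q≤
    pos≤ : ∀ {t} → Valid t → tilePos t ≤ suc (d * 2 * 2) * suc (d * 2)
    pos≤ {t} v = ℕ.≤-trans
      (ℕ.+-mono-≤ (ℕ.*-monoˡ-≤ (suc (d * 2)) (block≤ t v)) (ℕ.<⇒≤ (offset< t v)))
      (ℕ.≤-reflexive (ℕ.+-comm (d * 2 * 2 * suc (d * 2)) (suc (d * 2))))

  tileLayout-bad : length (badOrderings (Layout.graph tileLayout) (suc (d * 2))) < Layout.order tileLayout !
  tileLayout-bad = subst (λ k → length (badOrderings (Layout.graph tileLayout) k) < Layout.order tileLayout !)
    (cong tileColour tile-centre) (greedy-bad<! (Layout.graph tileLayout) tileGreedy centreVertex)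

-- From counts of orderings to expectations and the supremum

orderings-elements-unique : ∀ {n σ} → σ List.∈ orderings n → Unique σ
orderings-elements-unique {n} {σ} σ∈ =
  Perm.Unique-resp-↭ (setoid (Fin n)) (↭⇒↭ₛ (↭-sym (to (∈-orderings n σ) σ∈))) (Unique.allFin⁺ n)

sum-≤ : ∀ {a} {A : Set a} (f : A → ℕ) {k} xs → (∀ {x} → x List.∈ xs → f x ≤ k) → sum (map f xs) ≤ length xs * k
sum-≤ f []       le = z≤n
sum-≤ f (x ∷ xs) le = ℕ.+-mono-≤ (le (here refl)) (sum-≤ f xs λ p → le (there p))

-- Entries satisfying `P` are estimated by 0, at a cost of `k` each, which the last summand gives
-- back.
sum-≥ : ∀ {a p} {A : Set a} {P : A → Set p} (P? : Decidable P) (f : A → ℕ) {k} → (∀ {x} → ¬ P x → k ≤ f x) →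
        ∀ xs → length xs * k ≤ sum (map f xs) + length (filter P? xs) * k
sum-≥ P? f     ¬P⇒≥ []       = z≤n
sum-≥ P? f {k} ¬P⇒≥ (x ∷ xs) with P? x | sum-≥ P? f ¬P⇒≥ xs
... | yes _  | ih = begin
  k + length xs * k         ≤⟨ ℕ.+-monoʳ-≤ k ih ⟩
  k + (s + b * k)           ≤⟨ ℕ.m≤n+m _ (f x) ⟩
  f x + (k + (s + b * k))   ≡⟨ re (f x) k s (b * k) ⟩
  f x + s + (k + b * k)     ∎
  where
  open ℕ.≤-Reasoning
  s = sum (map f xs)
  b = length (filter P? xs)
  re : ∀ x k s t → x + (k + (s + t)) ≡ x + s + (k + t)
  re = solve-∀
... | no ¬Px | ih = subst (k + length xs * k ≤_) (sym (ℕ.+-assoc (f x) _ _)) (ℕ.+-mono-≤ (¬P⇒≥ ¬Px) ih)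

/≤⁺ : ∀ {a k t} .{{_ : NonZero t}} → a ≤ t * k → + a / t ≤ℚ + k / 1
/≤⁺ {a} {k} {suc t} le = ℚ.toℚᵘ-cancel-≤
  (ℚᵘ.≤-respˡ-≃ (ℚᵘ.≃-sym (toℚᵘ-/ t (+ a))) (ℚᵘ.≤-respʳ-≃ (ℚᵘ.≃-sym (toℚᵘ-/ 0 (+ k)))
    (*≤*ᵘ (subst₂ ℤ._≤_ (sym (ℤ.*-identityʳ (+ a))) (ℤ.pos-* k (suc t))
      (+≤+ (subst (a ≤_) (ℕ.*-comm (suc t) k) le))))))

</⁺ : ∀ r {s t} .{{_ : NonZero t}} → ↥ r ℤ.* + t ℤ.< + s ℤ.* ↧ r → r <ℚ + s / t
</⁺ (mkℚ _ _ _) {s} {suc t} lt = ℚ.toℚᵘ-cancel-< (ℚᵘ.<-respʳ-≃ (ℚᵘ.≃-sym (toℚᵘ-/ t (+ s))) (*<*ᵘ lt))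

</1⁻ : ∀ r {k} → r <ℚ + k / 1 → ↥ r ℤ.< + k ℤ.* ↧ r
</1⁻ (mkℚ _ _ _) {k} lt with ℚᵘ.<-respʳ-≃ (toℚᵘ-/ 0 (+ k)) (ℚ.toℚᵘ-mono-< lt)
... | *<*ᵘ p = subst (ℤ._< _) (ℤ.*-identityʳ _) p

-- A fraction a / b below the integer k is below it by at least 1 / b. At most the fraction f / F of
-- the `t` orderings is bad, so the mean s / t is at least k - k f / F. The summand k b f of F is
-- chosen to make k f / F smaller than 1 / b.
mean-close : ∀ a b k f t s x → 0 < f → 0 < t → a < k * b →
             t * k ≤ s + x * k → x * (f + k * b * f) ≤ f * t → a * t < s * b
mean-close a b k f t s x 0<f 0<t a<kb total bad = ℕ.*-cancelʳ-< F (a * t) (s * b) (begin-strict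
  a * t * F         ≡⟨ r₁ a t F ⟩
  a * F * t         <⟨ ℕ.*-monoˡ-< t {{>-nonZero 0<t}} aF<kbN ⟩
  k * b * N * t     ≡⟨ r₂ k b N t ⟩
  t * k * N * b     ≤⟨ ℕ.*-monoˡ-≤ b good ⟩
  s * F * b         ≡⟨ r₁ s F b ⟩
  s * b * F         ∎)
  where
  open ℕ.≤-Reasoning
  N = k * b * f
  F = f + N
  r₁ : ∀ x y z → x * y * z ≡ x * z * y
  r₁ = solve-∀
  r₂ : ∀ k b n t → k * b * n * t ≡ t * k * n * b
  r₂ = solve-∀
  r₃ : ∀ k b f n → k * b * (f + n) ≡ k * b * n + k * b * f
  r₃ = solve-∀
  r₄ : ∀ t k f n → t * k * n + f * t * k ≡ t * k * (f + n)
  r₄ = solve-∀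
  r₅ : ∀ s x k n → (s + x * k) * n ≡ s * n + x * n * k
  r₅ = solve-∀
  aF<kbN : a * F < k * b * N
  aF<kbN = ℕ.+-cancelʳ-< N (a * F) (k * b * N) (begin-strict
    a * F + N          <⟨ ℕ.+-monoʳ-< (a * F) (ℕ.m<n+m N 0<f) ⟩
    a * F + F          ≡⟨ ℕ.+-comm (a * F) F ⟩
    suc a * F          ≤⟨ ℕ.*-monoˡ-≤ F a<kb ⟩
    k * b * F          ≡⟨ r₃ k b f N ⟩
    k * b * N + N      ∎)
  good : t * k * N ≤ s * F
  good = ℕ.+-cancelʳ-≤ (f * t * k) (t * k * N) (s * F) (begin
    t * k * N + f * t * k   ≡⟨ r₄ t k f N ⟩
    t * k * F               ≤⟨ ℕ.*-monoˡ-≤ F total ⟩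
    (s + x * k) * F         ≡⟨ r₅ s x k F ⟩
    s * F + x * F * k       ≤⟨ ℕ.+-monoʳ-≤ (s * F) (ℕ.*-monoˡ-≤ k bad) ⟩
    s * F + f * t * k       ∎)

mean-close-ℚ : ∀ r k f t s x .{{_ : NonZero t}} → 0 < f → 0 < t → r <ℚ + k / 1 →
               t * k ≤ s + x * k → x * (f + k * ↧ₙ r * f) ≤ f * t → r <ℚ + s / t
-- A negative r is below any mean of natural numbers.
mean-close-ℚ r@(mkℚ -[1+ a ] b-1 _) k f (suc t) s x _ _ _ _ _ =
  </⁺ r {s} {suc t} (subst (-[1+ a ] ℤ.* + suc t ℤ.<_) (ℤ.pos-* s (suc b-1)) -<+)
mean-close-ℚ r@(mkℚ (+ a) b-1 _) k f t s x 0<f 0<t r<k total bad =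
  </⁺ r {s} {t} (subst₂ ℤ._<_ (ℤ.pos-* a t) (ℤ.pos-* s (suc b-1))
    (+<+ (mean-close a (suc b-1) k f t s x 0<f 0<t a<kb total bad)))
  where
  a<kb : a < k * suc b-1
  a<kb = ℤ.drop‿+<+ (subst (+ a ℤ.<_) (sym (ℤ.pos-* k (suc b-1))) (</1⁻ r {k} r<k))

ExpectedValue : ℕ → ℚ → Set₁
ExpectedValue ω q = ∃ λ n → Σ (Graph n) λ G → UnitInterval G × MaxCliqueSize G ω × q ≡ expectedColours G

module _ (d : ℕ) where

  private
    k : ℕ
    k = suc (d * 2)

  expectedColours-≤ : ∀ {n} (G : Graph n) → UnitInterval G → MaxCliqueSize G (suc d) →
                      expectedColours G ≤ℚ + k / 1
  expectedColours-≤ {n} G unit (_ , ω≤) = /≤⁺ {total} {k} {n !} {{n ℕ.!≢0}}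
    (subst (λ t → total ≤ t * k) (length-orderings n)
      (sum-≤ (coloursUsed G) (orderings n) λ {σ} σ∈ →
        subst (λ e → coloursUsed G σ ≤ suc e) (d+d≡d*2 d) (coloursUsed-≤ G (degree-bound G unit ω≤) (orderings-elements-unique σ∈))))
    where
    total = sum (map (coloursUsed G) (orderings n))

  expectedColours-> : ∀ (P : Layout (suc d) (d * 2)) f r → 0 < f → r <ℚ + k / 1 →
                      length (badOrderings (Layout.graph P) k) * (f + k * ↧ₙ r * f) ≤ f * Layout.order P ! →
                      r <ℚ expectedColours (Layout.graph P)
  expectedColours-> P f r 0<f r<k bad = mean-close-ℚ r k f (n !) (sum (map (coloursUsed G) (orderings n)))
      (length (badOrderings G k)) {{n ℕ.!≢0}} 0<f (ℕ.1≤n! n) r<k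
      (subst (λ t → t * k ≤ sum (map (coloursUsed G) (orderings n)) + length (badOrderings G k) * k)
        (length-orderings n)
        (sum-≥ (λ σ → coloursUsed G σ ℕ.<? k) (coloursUsed G) ℕ.≮⇒≥ (orderings n)))
      bad
    where
    G = Layout.graph P
    n = Layout.order P

  isSupremum : (Q : Layout (suc d) (d * 2)) → length (badOrderings (Layout.graph Q) k) < Layout.order Q ! →
               IsSupremum (ExpectedValue (suc d)) (+ k / 1)
  isSupremum Q Q-bad = (λ { _ (_ , G , unit , clique , refl) → expectedColours-≤ G unit clique }) , approach
    where
    f = Layout.order Q !

    close : ∀ r → r <ℚ + k / 1 →
            (∃ λ P → length (badOrderings (Layout.graph P) k) * (f + k * ↧ₙ r * f) ≤ f * Layout.order P !) →
            ∃ λ q → ExpectedValue (suc d) q × r <ℚ q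
    close r r<k (P , bad) = expectedColours (Layout.graph P)
      , (Layout.order P , Layout.graph P , posGraph-unit (d * 2) (Layout.pos P) , Layout.maxClique P , refl)
      , expectedColours-> P f r (ℕ.1≤n! (Layout.order Q)) r<k bad

    approach : ∀ r → r <ℚ + k / 1 → ∃ λ q → ExpectedValue (suc d) q × r <ℚ q
    -- The number of further copies of `Q` is the summand of F required by `mean-close`.
    approach r r<k = close r r<k (bad-copies (suc d) (d * 2) Q k Q-bad (k * ↧ₙ r * f))

1+d*2≡2*[1+d]∸1 : ∀ d → 1 + d * 2 ≡ d + (1 + (d + 0))
1+d*2≡2*[1+d]∸1 = solve-∀

theorem5 : (ω : ℕ) → 1 ≤ ω →
    IsSupremum
    (λ q → ∃ λ n → Σ (Graph n) λ G →
    UnitInterval G × MaxCliqueSize G ω × q ≡ expectedColours G)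
    (+ (2 * ω ∸ 1) / 1)
theorem5 (suc d) _ = subst (λ k → IsSupremum (ExpectedValue (suc d)) (+ k / 1))
  (1+d*2≡2*[1+d]∸1 d) (isSupremum d (tileLayout d) (tileLayout-bad d))
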